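{- For all integers $n,k$ with $0\le k<n$, $$o(n,k)=\sum_{k\le m\le n}\binom{n+1}{m+1}\,z(m,k)\,\frac{m-k}{n-k}\,(n-k)^{(n-m)},$$ and $o(n,n)=(2n-1)!!$ for all $n\ge 0$. Here $o(n,k)$ is the number of ordered labeled trees on $\{0,1,\dots,n\}$ whose maximal decreasing subtree has exactly $k$ edges, and $z(m,k)$ is the number of ordered labeled trees on $\{0,1,\dots,m\}$ that consist of a decreasing tree with $k$ edges together with $m-k$ additional increasing leaves attached to it.
   Context: An ordered tree is a rooted tree in which the children of each vertex are linearly ordered. An ordered labeled tree on $[0,n]:=\{0,1,\dots,n\}$ is an ordered tree whose vertex set is $[0,n]$ (so it has $n+1$ vertices; any vertex may be the root). An edge from a parent $u$ to a child $v$ is decreasing if $u>v$ and increasing if $u<v$. A tree is decreasing if all its edges are decreasing. The maximal decreasing subtree $\mathrm{MD}(T)$ of an ordered labeled tree $T$ is the maximal ordered subtree containing the root of $T$ all of whose edges are decreasing; that is, its vertices are exactly those $v$ such that every edge on the path from the root to $v$ is decreasing (the root included). $\mathcal{O}_{n,k}$ is the set of ordered labeled trees $T$ on $[0,n]$ such that $\mathrm{MD}(T)$ has exactly $k$ edges (equivalently $k+1$ vertices), and $o(n,k)=|\mathcal{O}_{n,k}|$. $\mathcal{Z}_{n,k}$ is the set of ordered labeled trees on $[0,n]$ obtained from a decreasing tree with $k$ edges by attaching $n-k$ additional increasing leaves; that is, the set of ordered labeled trees $T$ on $[0,n]$ such that $\mathrm{MD}(T)$ has exactly $k$ edges and each of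 the $n-k$ vertices not in $\mathrm{MD}(T)$ is a leaf of $T$ whose parent lies in $\mathrm{MD}(T)$ (and hence has a smaller label than the leaf). $z(n,k)=|\mathcal{Z}_{n,k}|$. $x^{(j)}:=x(x+1)\cdots(x+j-1)$ is the rising factorial, with $x^{(0)}=1$. $(2n-1)!!:=(2n-1)(2n-3)\cdots 3\cdot 1$, with $(-1)!!=1$. -}

module Defs where

open import Data.Integer.Base using (+_)
open import Data.List.Base using (List; []; _∷_; _++_; length; map; foldr; filter; upTo; cartesianProduct; cartesianProductWith)
open import Data.List.Membership.Propositional using (_∈_; _∉_)
open import Data.List.Membership.DecPropositional using () renaming (_∈?_ to ∈-dec)
open import Data.List.Membership.Propositional.Properties using (∈-cartesianProduct⁺; ∈-cartesianProductWith⁺; ∈-cartesianProductWith⁻; ∈-filter⁺; ∈-filter⁻; ∈-upTo⁺; ∈-upTo⁻)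
open import Data.List.Membership.Propositional.Properties.WithK using (unique∧set⇒bag)
open import Data.List.Properties using (length-++; length-upTo)
open import Data.List.Relation.Binary.BagAndSetEquality using (∼bag⇒↭)
open import Data.List.Relation.Binary.Permutation.Propositional.Properties using (↭-length)
open import Data.List.Relation.Unary.All as All using (All; []; _∷_; all?)
open import Data.List.Relation.Unary.All.Properties using (++⁻ˡ; ++⁻ʳ)
open import Data.List.Relation.Unary.AllPairs using ([]; _∷_)
open import Data.List.Relation.Unary.Any using (Any; here; there; any?)
open import Data.List.Relation.Unary.Unique.Propositional using (Unique)
open import Data.List.Relation.Unary.Unique.Propositional.Properties as Uniqueₚ using ()
open import Data.List.Relation.Unary.Unique.DecPropositional using () renaming (unique? to unique-dec)
open import Data.Nat.Base using (ℕ; zero; suc; _+_; _*_; _∸_; _≤_; _<_; s≤s; s≤s⁻¹; NonZero; >-nonZero)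
open import Data.Nat.Properties using (_≟_; _≤?_; _<?_; ≤-trans; ≤-reflexive; m≤m+n; m≤n+m; m<n⇒0<n∸m)
open import Data.Product.Base using (_×_; _,_; proj₁; proj₂)
open import Data.Rational.Base as ℚ using (ℚ; 0ℚ)
open import Function.Base using (_∘_)
open import Function.Bundles using (_⇔_; mk⇔; module Equivalence)
open import Relation.Binary.PropositionalEquality using (_≡_; _≢_; refl; trans; subst)
open import Relation.Nullary using (Dec; yes; no)
open import Relation.Nullary.Decidable using (map′; ¬?; _×-dec_; _→-dec_)
open import Relation.Unary using (Pred; Decidable)
open import Level using (0ℓ)

data Tree : Set where
  node : (root : ℕ) (children : List Tree) → Tree

mutual
  vertices : Tree → List ℕ
  vertices (node u ts) = u ∷ verticesᶠ ts

  verticesᶠ : List Tree → List ℕ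
  verticesᶠ []       = []
  verticesᶠ (t ∷ ts) = vertices t ++ verticesᶠ ts

-- Edges are (parent , child) pairs; childEdges u ts lists the edges of
-- node u ts.
childEdges : ℕ → List Tree → List (ℕ × ℕ)
childEdges u []               = []
childEdges u (node v ss ∷ ts) = (u , v) ∷ childEdges v ss ++ childEdges u ts

edges : Tree → List (ℕ × ℕ)
edges (node u ts) = childEdges u ts

-- T is an ordered labeled tree on [0,n]: no label is repeated, and the
-- labels are exactly 0,…,n.
IsTreeOn : ℕ → Tree → Set
IsTreeOn n T = Unique (vertices T) × (∀ v → v ∈ vertices T ⇔ v ≤ n)

-- pruneᶠ u ts treats ts as the children of a vertex labeled u: a child v
-- is kept (and pruned recursively) if u > v; otherwise the whole subtree
-- at v is removed.
pruneᶠ : ℕ → List Tree → List Tree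
pruneᶠ u [] = []
pruneᶠ u (node v ss ∷ ts) with v <? u
... | yes _ = node v (pruneᶠ v ss) ∷ pruneᶠ u ts
... | no  _ = pruneᶠ u ts

MD : Tree → Tree
MD (node u ts) = node u (pruneᶠ u ts)

𝒪 : ℕ → ℕ → Pred Tree 0ℓ
𝒪 n k T = IsTreeOn n T × length (edges (MD T)) ≡ k

IsLeaf : Tree → ℕ → Set
IsLeaf T v = All (λ e → proj₁ e ≢ v) (edges T)

ParentIn : List ℕ → Tree → ℕ → Set
ParentIn us T v = Any (λ e → proj₂ e ≡ v × proj₁ e ∈ us) (edges T)

𝒵 : ℕ → ℕ → Pred Tree 0ℓ
𝒵 n k T = 𝒪 n k T × All (λ v → v ∉ vertices (MD T) → IsLeaf T v × ParentIn (vertices (MD T)) T v) (vertices T)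

record Enumeration (P : Pred Tree 0ℓ) : Set where
  field
    elements : List Tree
    unique   : Unique elements
    ∈⇔       : ∀ {T} → T ∈ elements ⇔ P T

card : ∀ {P} → Enumeration P → ℕ
card E = length (Enumeration.elements E)

private
  infix 4 _∈?_
  _∈?_ : ∀ v (vs : List ℕ) → Dec (v ∈ vs)
  _∈?_ = ∈-dec _≟_

isTreeOn? : ∀ n → Decidable (IsTreeOn n)
isTreeOn? n T = unique-dec _≟_ (vertices T) ×-dec
  map′ (λ (a , b) v → mk⇔ (All.lookup a) (λ v≤n → All.lookup b (∈-upTo⁺ (s≤s v≤n))))
       (λ f → All.tabulate (λ {v} → Equivalence.to (f v)) ,
              All.tabulate (λ {v} v∈ → Equivalence.from (f v) (s≤s⁻¹ (∈-upTo⁻ v∈))))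
       (all? (_≤? n) (vertices T) ×-dec all? (_∈? vertices T) (upTo (suc n)))

𝒪? : ∀ n k → Decidable (𝒪 n k)
𝒪? n k T = isTreeOn? n T ×-dec (length (edges (MD T)) ≟ k)

𝒵? : ∀ n k → Decidable (𝒵 n k)
𝒵? n k T = 𝒪? n k T ×-dec all? outside? (vertices T)
  where
  outside? : ∀ v → Dec (v ∉ vertices (MD T) → IsLeaf T v × ParentIn (vertices (MD T)) T v)
  outside? v = ¬? (v ∈? vertices (MD T)) →-dec
    (all? (λ e → ¬? (proj₁ e ≟ v)) (edges T) ×-dec
     any? (λ e → (proj₂ e ≟ v) ×-dec (proj₁ e ∈? vertices (MD T))) (edges T))

consNode : ℕ × List Tree → List Tree → List Tree
consNode (v , ss) ts = node v ss ∷ ts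

-- A finite list without repetitions of forests with labels in vs, among
-- them all those with at most s vertices.
forests : List ℕ → ℕ → List (List Tree)
forests vs zero    = [] ∷ []
forests vs (suc s) =
  [] ∷ cartesianProductWith consNode (cartesianProduct vs (forests vs s)) (forests vs s)

trees : ℕ → List Tree
trees n = cartesianProductWith node (upTo (suc n)) (forests (upTo (suc n)) n)

forests-unique : ∀ {vs} → Unique vs → ∀ s → Unique (forests vs s)
forests-unique u zero    = [] ∷ []
forests-unique {vs} u (suc s) =
  All.tabulate ([]≢ (cartesianProduct vs (forests vs s)) (forests vs s)) ∷
  Uniqueₚ.cartesianProductWith⁺ consNode inj
    (Uniqueₚ.cartesianProduct⁺ u (forests-unique u s)) (forests-unique u s)
  where
  []≢ : ∀ xs ys {x} → x ∈ cartesianProductWith consNode xs ys → [] ≢ x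
  []≢ xs ys x∈ refl with ∈-cartesianProductWith⁻ consNode xs ys x∈
  ... | _ , _ , _ , _ , ()
  inj : ∀ {w x y z} → consNode w y ≡ consNode x z → w ≡ x × y ≡ z
  inj refl = refl , refl

trees-unique : ∀ n → Unique (trees n)
trees-unique n = Uniqueₚ.cartesianProductWith⁺ node (λ { refl → refl , refl })
  (Uniqueₚ.upTo⁺ (suc n)) (forests-unique (Uniqueₚ.upTo⁺ (suc n)) n)

forests-complete : ∀ vs s ts → All (_∈ vs) (verticesᶠ ts) → length (verticesᶠ ts) ≤ s → ts ∈ forests vs s
forests-complete vs zero    []               _        _  = here refl
forests-complete vs zero    (node _ _ ∷ _)   _        ()
forests-complete vs (suc s) []               _        _  = here refl
forests-complete vs (suc s) (node v ss ∷ ts) (v∈ ∷ a) (s≤s l) =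
  there (∈-cartesianProductWith⁺ consNode
    (∈-cartesianProduct⁺ v∈ (forests-complete vs s ss (++⁻ˡ (verticesᶠ ss) a)
      (≤-trans (m≤m+n _ _) l′)))
    (forests-complete vs s ts (++⁻ʳ (verticesᶠ ss) a) (≤-trans (m≤n+m _ _) l′)))
  where
  l′ : length (verticesᶠ ss) + length (verticesᶠ ts) ≤ s
  l′ = subst (_≤ s) (length-++ (verticesᶠ ss)) l

trees-complete : ∀ {n T} → IsTreeOn n T → T ∈ trees n
trees-complete {n} {T@(node u ts)} (uniq , range) with All.tabulate {xs = vertices T} label∈
  where
  label∈ : ∀ {v} → v ∈ vertices T → v ∈ upTo (suc n)
  label∈ {v} v∈ = ∈-upTo⁺ (s≤s (Equivalence.to (range v) v∈))
... | u∈ ∷ a = ∈-cartesianProductWith⁺ node u∈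
  (forests-complete _ n ts a (s≤s⁻¹ (≤-reflexive size)))
  where
  size : length (vertices T) ≡ suc n
  size = trans
    (↭-length (∼bag⇒↭ (unique∧set⇒bag uniq (Uniqueₚ.upTo⁺ (suc n)) (λ {v} → mk⇔
      (λ v∈ → ∈-upTo⁺ (s≤s (Equivalence.to (range v) v∈)))
      (λ v∈ → Equivalence.from (range v) (s≤s⁻¹ (∈-upTo⁻ v∈)))))))
    (length-upTo (suc n))

enumerate : ∀ n {P : Pred Tree 0ℓ} → Decidable P → (∀ {T} → P T → IsTreeOn n T) → Enumeration P
enumerate n P? on = record
  { elements = filter P? (trees n)
  ; unique   = Uniqueₚ.filter⁺ P? (trees-unique n)
  ; ∈⇔       = mk⇔ (λ T∈ → proj₂ (∈-filter⁻ P? {xs = trees n} T∈))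
                   (λ p → ∈-filter⁺ P? (trees-complete (on p)) p)
  }

𝒪-enumeration : ∀ n k → Enumeration (𝒪 n k)
𝒪-enumeration n k = enumerate n (𝒪? n k) proj₁

𝒵-enumeration : ∀ n k → Enumeration (𝒵 n k)
𝒵-enumeration n k = enumerate n (𝒵? n k) (proj₁ ∘ proj₁)

o : ℕ → ℕ → ℕ
o n k = card (𝒪-enumeration n k)

z : ℕ → ℕ → ℕ
z n k = card (𝒵-enumeration n k)

-- x ⁽ j ⁾ = x (x + 1) ⋯ (x + j - 1)
infix 9 _⁽_⁾
_⁽_⁾ : ℕ → ℕ → ℕ
x ⁽ zero  ⁾ = 1
x ⁽ suc j ⁾ = x ⁽ j ⁾ * (x + j)

-- [2 n -1]!! = (2n-1)(2n-3) ⋯ 3 · 1; note 2(n+1) - 1 = 2n + 1.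
[2_-1]!! : ℕ → ℕ
[2 zero  -1]!! = 1
[2 suc n -1]!! = (2 * n + 1) * [2 n -1]!!

fromℕ : ℕ → ℚ
fromℕ a = + a ℚ./ 1

-- The sum of f m over a ≤ m ≤ b.
sumBetween : ℕ → ℕ → (ℕ → ℚ) → ℚ
sumBetween a b f = foldr ℚ._+_ 0ℚ (map (λ i → f (a + i)) (upTo (suc b ∸ a)))

syntax sumBetween a b (λ m → e) = ∑[ a ≤ m ≤ b ] e

∸-nonZero : ∀ {k n} → k < n → NonZero (n ∸ k)
∸-nonZero k<n = >-nonZero (m<n⇒0<n∸m k<n)

{-# OPTIONS --safe #-}
module Submission where

-- Deleting from a tree the proper descendants of the topmost vertices outside
-- its maximal decreasing subtree leaves a tree as counted by z, on m + 1 of the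
-- n + 1 labels.  What was deleted is m − k ordered forests on n − m labels, of
-- which there are (m − k)/(n − k) times the rising factorial (n − k)^(n − m), by
-- the recurrence f(r + 1, j) = f(r, j) + j f(r + 2, j − 1): either the first of the r + 1
-- forests is empty, or deleting the root of its first tree leaves r + 2 forests.
--
-- Trees are built in preorder: the state is a stack of unfinished child lists
-- with the labels of their parents in the maximal decreasing subtree, and a
-- number of untouched child lists elsewhere.  The counts for 𝒪 and 𝒵 obey the
-- same recursion and differ only in the weight of the untouched lists, so the
-- formula is proved by induction along this recursion, exchanging the choice of
-- the m + 1 labels with the choice of the next vertex.
--
-- The vertex with the smallest label of a decreasing tree is a leaf, and can be
-- inserted into a decreasing tree with n edges at 2n + 1 places.

open import Defs
open import Data.Empty using (⊥; ⊥-elim)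
open import Data.List.Base using (List; []; _∷_; _++_; length; map; upTo; foldr; applyUpTo)
open import Data.List.Membership.Propositional using (_∈_; _∉_)
open import Data.List.Membership.Propositional.Properties using (∈-map⁺; ∈-map⁻; ∈-++⁺ˡ; ∈-++⁺ʳ; ∈-++⁻; ∈-upTo⁺; ∈-upTo⁻)
open import Data.List.Membership.Propositional.Properties.WithK using (unique∧set⇒bag)
open import Data.List.Properties using (length-++; length-map; length-upTo; map-upTo; ++-assoc; ++-identityʳ)
open import Data.List.Relation.Binary.BagAndSetEquality using (∼bag⇒↭)
open import Data.List.Relation.Binary.Disjoint.Propositional using (Disjoint)
open import Data.List.Relation.Binary.Permutation.Propositional using (_↭_; prep; ↭-refl; ↭-sym; ↭-trans; ↭-reflexive; ↭⇒↭ₛ)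
open import Data.List.Relation.Binary.Permutation.Propositional.Properties using (↭-length; ∈-resp-↭; drop-∷; shifts)
import Data.List.Relation.Binary.Permutation.Setoid.Properties as Permutationₛ
open import Data.List.Relation.Unary.All as All using (All; []; _∷_)
import Data.List.Relation.Unary.All.Properties as Allₚ
open import Data.List.Relation.Unary.AllPairs using ([]; _∷_)
open import Data.List.Relation.Unary.Any as Any using (Any; here; there)
import Data.List.Relation.Unary.Any.Properties as Anyₚ
open import Data.List.Relation.Unary.Unique.Propositional using (Unique)
import Data.List.Relation.Unary.Unique.Propositional.Properties as Uniqueₚ
open import Data.Nat.Base using (ℕ; zero; suc; _+_; _∸_; _≤_; _<_; z≤n; s≤s; s≤s⁻¹; NonZero) renaming (_*_ to infixl 7 _·_)
open import Data.Nat.Combinatorics using (_C_; nCn≡1; nCk≡nC[n∸k]; nCk+nC[k+1]≡[n+1]C[k+1]; k>n⇒nCk≡0)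
open import Data.Nat.Properties
open import Data.Nat.Tactic.RingSolver using (solve-∀)
open import Data.Product.Base using (_×_; _,_; proj₁; proj₂; ∃-syntax; ∃₂)
open import Data.Sum.Base using (_⊎_; inj₁; inj₂; [_,_]′)
open import Data.Unit.Base using (⊤; tt)
open import Data.Vec.Base as Vec using (Vec; []; _∷_)
open import Data.Vec.Relation.Unary.All as VecAll using ([]; _∷_) renaming (All to VAll)
open import Algebra.Properties.CommutativeSemigroup +-commutativeSemigroup using (interchange)
open import Function.Base using (_∘_; id)
open import Function.Bundles using (mk⇔; module Equivalence)
open import Relation.Binary.PropositionalEquality using (_≡_; _≢_; refl; sym; trans; cong; cong₂; subst; setoid; module ≡-Reasoning)
open import Relation.Nullary using (Dec; yes; no; ¬_)

private variable
  A B : Set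
  P Q R : A → Set
  c d : ℕ

-- Sums over removals of one entry and over splittings into two subsequences

data Pick {A : Set} : A → List A → List A → Set where
  here  : ∀ {x xs} → Pick x xs (x ∷ xs)
  there : ∀ {x y ys xs} → Pick y ys xs → Pick y (x ∷ ys) (x ∷ xs)

∑pick : List A → (A → List A → ℕ) → ℕ
∑pick []       g = 0
∑pick (x ∷ xs) g = g x xs + ∑pick xs (λ y ys → g y (x ∷ ys))

∑split : List A → (List A → List A → ℕ) → ℕ
∑split []       g = g [] []
∑split (x ∷ xs) g = ∑split xs (λ ys zs → g (x ∷ ys) zs) + ∑split xs (λ ys zs → g ys (x ∷ zs))

Pick-length : ∀ {x : A} {xs L} → Pick x xs L → length L ≡ suc (length xs)
Pick-length here      = refl
Pick-length (there p) = cong suc (Pick-length p)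

Pick-All : ∀ {P : A → Set} {x xs L} → Pick x xs L → All P L → P x × All P xs
Pick-All here      (px ∷ pxs) = px , pxs
Pick-All (there p) (py ∷ pys) with px , pxs ← Pick-All p pys = px , py ∷ pxs

∑pick-cong : ∀ (L : List A) {g h : A → List A → ℕ} →
             (∀ {x xs} → Pick x xs L → g x xs ≡ h x xs) → ∑pick L g ≡ ∑pick L h
∑pick-cong []      eq = refl
∑pick-cong (x ∷ L) eq = cong₂ _+_ (eq here) (∑pick-cong L (eq ∘ there))

∑pick-0 : ∀ (L : List A) {g : A → List A → ℕ} →
          (∀ {x xs} → Pick x xs L → g x xs ≡ 0) → ∑pick L g ≡ 0
∑pick-0 []      eq = refl
∑pick-0 (x ∷ L) eq = cong₂ _+_ (eq here) (∑pick-0 L (eq ∘ there))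

∑pick-const : ∀ (L : List A) c → ∑pick L (λ _ _ → c) ≡ length L · c
∑pick-const []      c = refl
∑pick-const (x ∷ L) c = cong (c +_) (∑pick-const L c)

∑pick-*ʳ : ∀ (L : List A) g c → ∑pick L g · c ≡ ∑pick L (λ x xs → g x xs · c)
∑pick-*ʳ []      g c = refl
∑pick-*ʳ (x ∷ L) g c = trans (*-distribʳ-+ c (g x L) _) (cong (g x L · c +_) (∑pick-*ʳ L _ c))

∑pick-+ : ∀ (L : List A) g h → ∑pick L (λ x xs → g x xs + h x xs) ≡ ∑pick L g + ∑pick L h
∑pick-+ []      g h = refl
∑pick-+ (x ∷ L) g h = trans (cong (g x L + h x L +_) (∑pick-+ L _ _)) (interchange (g x L) (h x L) _ _)

∑pick-map : ∀ (h : A → B) L g → ∑pick (map h L) g ≡ ∑pick L (λ x xs → g (h x) (map h xs))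
∑pick-map h []      g = refl
∑pick-map h (x ∷ L) g = cong (g (h x) (map h L) +_) (∑pick-map h L _)

∑split-cong : ∀ (L : List A) {g h : List A → List A → ℕ} →
              (∀ xs ys → g xs ys ≡ h xs ys) → ∑split L g ≡ ∑split L h
∑split-cong []      eq = eq [] []
∑split-cong (x ∷ L) eq = cong₂ _+_ (∑split-cong L (λ _ _ → eq _ _)) (∑split-cong L (λ _ _ → eq _ _))

∑split-0 : ∀ (L : List A) → ∑split L (λ _ _ → 0) ≡ 0
∑split-0 []      = refl
∑split-0 (x ∷ L) = cong₂ _+_ (∑split-0 L) (∑split-0 L)

∑split-+ : ∀ (L : List A) g h → ∑split L (λ xs ys → g xs ys + h xs ys) ≡ ∑split L g + ∑split L h
∑split-+ []      g h = refl
∑split-+ (x ∷ L) g h = trans (cong₂ _+_ (∑split-+ L _ _) (∑split-+ L _ _)) (interchange (∑split L _) _ _ _)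

-- Both sides choose one entry and divide the others into two subsequences; on the left-hand side
-- the chosen entry is counted in the first part. This exchanges the choice of a label set with the
-- choice of the next vertex.
∑split-∑pick : ∀ (L : List A) (g : A → List A → List A → ℕ) →
  ∑split L (λ xs zs → ∑pick xs (λ y ys → g y ys zs)) ≡ ∑pick L (λ x xs → ∑split xs (g x))
∑split-∑pick []      g = refl
∑split-∑pick (x ∷ L) g = begin
    ∑split L (λ xs zs → g x xs zs + ∑pick xs (λ y ys → g y (x ∷ ys) zs))
  + ∑split L (λ xs zs → ∑pick xs (λ y ys → g y ys (x ∷ zs)))
    ≡⟨ cong₂ _+_ (trans (∑split-+ L _ _) (cong (∑split L (g x) +_) (∑split-∑pick L _))) (∑split-∑pick L _) ⟩
    ∑split L (g x) + ∑pick L (λ y ys → ∑split ys (λ xs zs → g y (x ∷ xs) zs))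
  + ∑pick L (λ y ys → ∑split ys (λ xs zs → g y xs (x ∷ zs)))
    ≡⟨ +-assoc (∑split L (g x)) _ _ ⟩
    ∑split L (g x) + (∑pick L (λ y ys → ∑split ys (λ xs zs → g y (x ∷ xs) zs))
  + ∑pick L (λ y ys → ∑split ys (λ xs zs → g y xs (x ∷ zs))))
    ≡⟨ cong (∑split L (g x) +_) (∑pick-+ L _ _) ⟨
    ∑split L (g x) + ∑pick L (λ y ys → ∑split (x ∷ ys) (g y)) ∎
  where open ≡-Reasoning

-- Counting fillings of slots

δ₀ : ℕ → ℕ
δ₀ zero    = 1
δ₀ (suc _) = 0

∑split-δ₀ : ∀ (L : List A) (g : List A → List A → ℕ) → ∑split L (λ xs ys → δ₀ (length xs) · g xs ys) ≡ g [] L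
∑split-δ₀ []      g = +-identityʳ _
∑split-δ₀ (x ∷ L) g = cong₂ _+_ (∑split-0 L) (∑split-δ₀ L _)

-- A decreasing new edge uses up one of the `k` edges still owed to the maximal decreasing subtree;
-- an increasing one leaves `k` as it is.
step : {P : Set} → Dec P → (ℕ → ℕ) → (ℕ → ℕ) → ℕ → ℕ
step (yes _) dec inc zero    = 0
step (yes _) dec inc (suc k) = dec k
step (no  _) dec inc k       = inc k

step-cong : ∀ {P : Set} (d : Dec P) {f f′ g g′ : ℕ → ℕ} → (∀ k → f k ≡ f′ k) → (∀ k → g k ≡ g′ k) →
            ∀ k → step d f g k ≡ step d f′ g′ k
step-cong (yes _) f≗ g≗ zero    = refl
step-cong (yes _) f≗ g≗ (suc k) = f≗ k
step-cong (no  _) f≗ g≗ k       = g≗ k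

-- count φ us r L k: the number of ways to distribute the labels L over a
-- stack of child lists of the vertices us of the maximal decreasing subtree
-- and over r child lists of other vertices, such that k of the labels
-- become vertices of the maximal decreasing subtree; φ r j is the number of
-- ways to fill the latter r child lists with j labels.
countFuel : (ℕ → ℕ → ℕ) → ℕ → List ℕ → ℕ → List ℕ → ℕ → ℕ
countFuel φ n       []       r L k = δ₀ k · φ r (length L)
countFuel φ zero    (u ∷ us) r L k = countFuel φ zero us r L k
countFuel φ (suc n) (u ∷ us) r L k = countFuel φ (suc n) us r L k +
  ∑pick L (λ v L′ → step (v <? u) (countFuel φ n (v ∷ u ∷ us) r L′) (countFuel φ n (u ∷ us) (suc r) L′) k)

-- The length of `L` is enough fuel: every step that spends fuel also removes a label, and at fuel
-- zero it only remains to close the open child lists.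
count : (ℕ → ℕ → ℕ) → List ℕ → ℕ → List ℕ → ℕ → ℕ
count φ us r L k = countFuel φ (length L) us r L k

-- Preorder traversal: either the child list of `u` ends here, or `v` is its next child. A smaller
-- `v` joins the subtree and its own child list is opened on top of the stack; otherwise that list
-- joins the untouched ones.
count-∷ : ∀ φ u us r L k → count φ (u ∷ us) r L k ≡ count φ us r L k +
  ∑pick L (λ v L′ → step (v <? u) (count φ (v ∷ u ∷ us) r L′) (count φ (u ∷ us) (suc r) L′) k)
count-∷ φ u us r []         k = sym (+-identityʳ _)
count-∷ φ u us r L@(_ ∷ L₀) k = cong (count φ us r L k +_) (∑pick-cong L (λ {v} {L′} p →
  cong (λ n → step (v <? u) (countFuel φ n (v ∷ u ∷ us) r L′) (countFuel φ n (u ∷ us) (suc r) L′) k)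
       (suc-injective (Pick-length p))))

-- Lexicographic induction: picking a label may lengthen the stack but shortens `L`, while closing a
-- list keeps `L` and shortens the stack.
count-induction : (P : List ℕ → ℕ → List ℕ → Set) →
  (∀ r L → P [] r L) →
  (∀ u us r L → P us r L → (∀ {v L′} → Pick v L′ L → P (v ∷ u ∷ us) r L′ × P (u ∷ us) (suc r) L′) → P (u ∷ us) r L) →
  ∀ us r L → P us r L
count-induction P base ind us r L = go (length L) us r L refl
  where
  go : ∀ n us r L → length L ≡ n → P us r L
  go n       []       r L eq = base r L
  go zero    (u ∷ us) r [] eq = ind u us r [] (go zero us r [] eq) λ ()
  go (suc n) (u ∷ us) r L eq = ind u us r L (go (suc n) us r L eq) λ p →
    let eq′ = suc-injective (trans (sym (Pick-length p)) eq)
    in go n _ r _ eq′ , go n _ (suc r) _ eq′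

count-vanish : ∀ φ us r L k → length L < k → count φ us r L k ≡ 0
count-vanish φ = count-induction (λ us r L → ∀ k → length L < k → count φ us r L k ≡ 0)
  (λ { r L (suc k) lt → refl })
  (λ u us r L ih₀ ih k lt → trans (count-∷ φ u us r L k)
    (cong₂ _+_ (ih₀ k lt) (∑pick-0 L (λ {v} {L′} p →
      vanish (v <? u) k (subst (_< k) (Pick-length p) lt) (proj₁ (ih p)) (proj₂ (ih p))))))
  where
  vanish : ∀ {P : Set} (d : Dec P) {f g l} k → suc l < k → (∀ k → l < k → f k ≡ 0) →
           (∀ k → l < k → g k ≡ 0) → step d f g k ≡ 0
  vanish (yes _) (suc k) lt f0 g0 = f0 k (s≤s⁻¹ lt)
  vanish (no  _) k       lt f0 g0 = g0 k (<-trans (n<1+n _) lt)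

-- Labels enter only through the comparisons `v <? u`, and the two hypotheses on `h` make these
-- decisions agree before and after relabelling.
count-map : ∀ φ (h : ℕ → ℕ) → (∀ {a b} → a < b → h a < h b) → (∀ {a b} → h a < h b → a < b) →
            ∀ us r L k → count φ (map h us) r (map h L) k ≡ count φ us r L k
count-map φ h mono cancel = count-induction
  (λ us r L → ∀ k → count φ (map h us) r (map h L) k ≡ count φ us r L k)
  (λ r L k → cong (λ l → δ₀ k · φ r l) (length-map h L))
  (λ u us r L ih₀ ih k → trans (count-∷ φ (h u) (map h us) r (map h L) k)
    (trans (cong₂ _+_ (ih₀ k) (trans (∑pick-map h L _) (∑pick-cong L (λ {v} {L′} p →
      trans (same (h v <? h u) (v <? u) cancel mono k)
            (step-cong (v <? u) (proj₁ (ih p)) (proj₂ (ih p)) k)))))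
    (sym (count-∷ φ u us r L k))))
  where
  same : ∀ {P Q : Set} (d : Dec P) (e : Dec Q) → (P → Q) → (Q → P) →
         ∀ {f g} k → step d f g k ≡ step e f g k
  same (yes p) (yes q) to from zero    = refl
  same (yes p) (yes q) to from (suc k) = refl
  same (yes p) (no ¬q) to from k       = ⊥-elim (¬q (to p))
  same (no ¬p) (yes q) to from k       = ⊥-elim (¬p (from q))
  same (no ¬p) (no ¬q) to from k       = refl

-- The labels S are those of the maximal decreasing subtree and of its
-- increasing children; there are r + (|S| ∸ k) lists to be filled with the
-- remaining labels.
count-split : ∀ φ us r L q k → count φ us r L k ≡
  ∑split L (λ S R → count (λ _ → δ₀) us q S k · φ (r + (length S ∸ k)) (length R))
count-split φ = count-induction Splits base ind
  where
  open ≡-Reasoning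
  Z : List ℕ → ℕ → List ℕ → ℕ → ℕ
  Z = count (λ _ → δ₀)

  -- `q` is quantified here because an increasing child adds an untouched list on both sides, so the
  -- hypothesis is applied at `suc q`.
  Splits : List ℕ → ℕ → List ℕ → Set
  Splits us r L = ∀ q k → count φ us r L k ≡
    ∑split L (λ S R → Z us q S k · φ (r + (length S ∸ k)) (length R))

  base : ∀ r L q k → δ₀ k · φ r (length L) ≡
    ∑split L (λ S R → δ₀ k · δ₀ (length S) · φ (r + (length S ∸ k)) (length R))
  base r L q zero = begin
    φ r (length L) + 0
      ≡⟨ cong (λ s → φ s (length L) + 0) (+-identityʳ r) ⟨
    φ (r + 0) (length L) + 0
      ≡⟨ +-identityʳ _ ⟩
    φ (r + 0) (length L)
      ≡⟨ ∑split-δ₀ L (λ S R → φ (r + length S) (length R)) ⟨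
    ∑split L (λ S R → δ₀ (length S) · φ (r + length S) (length R))
      ≡⟨ ∑split-cong L (λ S R → cong (_· φ (r + length S) (length R)) (+-identityʳ (δ₀ (length S)))) ⟨
    ∑split L (λ S R → (δ₀ (length S) + 0) · φ (r + length S) (length R)) ∎
  base r L q (suc k) = sym (∑split-0 L)

  branch : ∀ {P : Set} (d : Dec P) u v us r L q →
    Splits (v ∷ u ∷ us) r L → Splits (u ∷ us) (suc r) L →
    ∀ k → step d (count φ (v ∷ u ∷ us) r L) (count φ (u ∷ us) (suc r) L) k ≡
      ∑split L (λ S R → step d (Z (v ∷ u ∷ us) q S) (Z (u ∷ us) (suc q) S) k
                        · φ (r + (suc (length S) ∸ k)) (length R))
  branch (yes _) u v us r L q ih₁ ih₂ zero    = sym (∑split-0 L)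
  branch (yes _) u v us r L q ih₁ ih₂ (suc k) = ih₁ q k
  branch (no  _) u v us r L q ih₁ ih₂ k       = trans (ih₂ (suc q) k) (∑split-cong L move)
    where
    move : ∀ S R → Z (u ∷ us) (suc q) S k · φ (suc r + (length S ∸ k)) (length R)
                 ≡ Z (u ∷ us) (suc q) S k · φ (r + (suc (length S) ∸ k)) (length R)
    -- The new list can move from `suc r` into the difference only if `k ≤ length S`. Otherwise the
    -- subtraction truncates, but then both sides are 0.
    move S R with k ≤? length S
    ... | yes k≤ = cong (λ s → Z (u ∷ us) (suc q) S k · φ s (length R))
                     (trans (sym (+-suc r _)) (cong (r +_) (sym (+-∸-assoc 1 k≤))))
    ... | no k≰  = trans (cong (_· φ (suc r + (length S ∸ k)) (length R)) Z≡0)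
                         (cong (_· φ (r + (suc (length S) ∸ k)) (length R)) (sym Z≡0))
      where
      Z≡0 : Z (u ∷ us) (suc q) S k ≡ 0
      Z≡0 = count-vanish (λ _ → δ₀) (u ∷ us) (suc q) S k (≰⇒> k≰)

  ind : ∀ u us r L → Splits us r L →
        (∀ {v L′} → Pick v L′ L → Splits (v ∷ u ∷ us) r L′ × Splits (u ∷ us) (suc r) L′) →
        Splits (u ∷ us) r L
  ind u us r L ih₀ ih q k = begin
    count φ (u ∷ us) r L k
      ≡⟨ count-∷ φ u us r L k ⟩
    count φ us r L k + ∑pick L (λ v L′ → step (v <? u) (count φ (v ∷ u ∷ us) r L′) (count φ (u ∷ us) (suc r) L′) k)
      ≡⟨ cong₂ _+_ (ih₀ q k) (∑pick-cong L (λ {v} {L′} p →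
           branch (v <? u) u v us r L′ q (proj₁ (ih p)) (proj₂ (ih p)) k)) ⟩
    ∑split L (λ S R → Z us q S k · w S R) + ∑pick L (λ v L′ → ∑split L′ (λ S R → zstep v S · φ (r + (suc (length S) ∸ k)) (length R)))
      ≡⟨ cong (∑split L (λ S R → Z us q S k · w S R) +_) (∑split-∑pick L _) ⟨
    ∑split L (λ S R → Z us q S k · w S R) + ∑split L (λ S R → ∑pick S (λ v S′ → zstep v S′ · φ (r + (suc (length S′) ∸ k)) (length R)))
      ≡⟨ ∑split-+ L _ _ ⟨
    ∑split L (λ S R → Z us q S k · w S R + ∑pick S (λ v S′ → zstep v S′ · φ (r + (suc (length S′) ∸ k)) (length R)))
      ≡⟨ ∑split-cong L collect ⟩
    ∑split L (λ S R → Z (u ∷ us) q S k · w S R) ∎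
    where
    w : List ℕ → List ℕ → ℕ
    w S R = φ (r + (length S ∸ k)) (length R)
    zstep : ℕ → List ℕ → ℕ
    zstep v S = step (v <? u) (Z (v ∷ u ∷ us) q S) (Z (u ∷ us) (suc q) S) k
    -- Now `v` is picked from `S`, so `suc (length S′)` is `length S`; the weight is the same for
    -- all picks and factors out.
    collect : ∀ S R → Z us q S k · w S R + ∑pick S (λ v S′ → zstep v S′ · φ (r + (suc (length S′) ∸ k)) (length R))
                    ≡ Z (u ∷ us) q S k · w S R
    collect S R = begin
      Z us q S k · w S R + ∑pick S (λ v S′ → zstep v S′ · φ (r + (suc (length S′) ∸ k)) (length R))
        ≡⟨ cong (Z us q S k · w S R +_) (∑pick-cong S (λ {v} {S′} p →
             cong (λ l → zstep v S′ · φ (r + (l ∸ k)) (length R)) (Pick-length p))) ⟨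
      Z us q S k · w S R + ∑pick S (λ v S′ → zstep v S′ · w S R)
        ≡⟨ cong (Z us q S k · w S R +_) (∑pick-*ʳ S zstep (w S R)) ⟨
      Z us q S k · w S R + ∑pick S zstep · w S R
        ≡⟨ *-distribʳ-+ (w S R) (Z us q S k) _ ⟨
      (Z us q S k + ∑pick S zstep) · w S R
        ≡⟨ cong (_· w S R) (count-∷ (λ _ → δ₀) u us q S k) ⟨
      Z (u ∷ us) q S k · w S R ∎

-- The root belongs to the maximal decreasing subtree but is not counted by `k`, which counts edges.
-- Its child list is the only one open at the start.
totalCount : (ℕ → ℕ → ℕ) → List ℕ → ℕ → ℕ
totalCount φ L k = ∑pick L (λ v L′ → count φ (v ∷ []) 0 L′ k)

-- Here `S` includes the root, so `length S ∸ 1 ∸ k` is the number of topmost vertices outside the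
-- maximal decreasing subtree.
totalCount-split : ∀ φ L k → totalCount φ L k ≡
  ∑split L (λ S R → totalCount (λ _ → δ₀) S k · φ (length S ∸ 1 ∸ k) (length R))
totalCount-split φ L k = begin
  ∑pick L (λ v L′ → count φ (v ∷ []) 0 L′ k)
    ≡⟨ ∑pick-cong L (λ {v} {L′} p → count-split φ (v ∷ []) 0 L′ 0 k) ⟩
  ∑pick L (λ v L′ → ∑split L′ (λ S R → count (λ _ → δ₀) (v ∷ []) 0 S k · φ (length S ∸ k) (length R)))
    ≡⟨ ∑split-∑pick L _ ⟨
  ∑split L (λ S R → ∑pick S (λ v S′ → count (λ _ → δ₀) (v ∷ []) 0 S′ k · φ (length S′ ∸ k) (length R)))
    ≡⟨ ∑split-cong L (λ S R → trans
         (∑pick-cong S (λ {v} {S′} p → cong (λ l → count (λ _ → δ₀) (v ∷ []) 0 S′ k · φ (l ∸ 1 ∸ k) (length R))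
           (sym (Pick-length p))))
         (sym (∑pick-*ʳ S _ (φ (length S ∸ 1 ∸ k) (length R))))) ⟩
  ∑split L (λ S R → totalCount (λ _ → δ₀) S k · φ (length S ∸ 1 ∸ k) (length R)) ∎
  where open ≡-Reasoning

totalCount-vanish : ∀ φ L k → length L ≤ k → totalCount φ L k ≡ 0
totalCount-vanish φ L k L≤k = ∑pick-0 L (λ {v} {L′} p →
  count-vanish φ (v ∷ []) 0 L′ k (≤-trans (≤-reflexive (sym (Pick-length p))) L≤k))

-- Relabelling

data Increasing (b : ℕ) : List ℕ → Set where
  []  : Increasing b []
  _∷_ : ∀ {x xs} → b ≤ x → Increasing (suc x) xs → Increasing b (x ∷ xs)

Increasing-weaken : ∀ {a b L} → a ≤ b → Increasing b L → Increasing a L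
Increasing-weaken a≤b []         = []
Increasing-weaken a≤b (b≤x ∷ is) = ≤-trans a≤b b≤x ∷ is

Increasing⇒All : ∀ {b L} → Increasing b L → All (b ≤_) L
Increasing⇒All []         = []
Increasing⇒All (b≤x ∷ is) = b≤x ∷ All.map (≤-trans (m≤n⇒m≤1+n b≤x)) (Increasing⇒All is)

∑split-cong-Increasing : ∀ {b L} → Increasing b L → {g h : List ℕ → List ℕ → ℕ} →
  (∀ xs ys → Increasing b xs → g xs ys ≡ h xs ys) → ∑split L g ≡ ∑split L h
∑split-cong-Increasing []         eq = eq [] [] []
∑split-cong-Increasing (b≤x ∷ is) eq = cong₂ _+_
  (∑split-cong-Increasing is (λ xs ys inc → eq _ _ (b≤x ∷ inc)))
  (∑split-cong-Increasing is (λ xs ys inc → eq _ _ (Increasing-weaken (m≤n⇒m≤1+n b≤x) inc)))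

applyUpTo-Increasing : ∀ (h : ℕ → ℕ) b → b ≤ h 0 → (∀ i → h i < h (suc i)) → ∀ n → Increasing b (applyUpTo h n)
applyUpTo-Increasing h b b≤ h< zero    = []
applyUpTo-Increasing h b b≤ h< (suc n) = b≤ ∷ applyUpTo-Increasing (h ∘ suc) (suc (h 0)) (h< 0) (h< ∘ suc) n

upTo-Increasing : ∀ n → Increasing 0 (upTo n)
upTo-Increasing = applyUpTo-Increasing id 0 z≤n n<1+n

-- To be strictly increasing on all of `ℕ`, `h` continues past the end of the list in steps of one.
enumerator : ∀ {b L} → Increasing b L →
  ∃[ h ] b ≤ h 0 × (∀ i → h i < h (suc i)) × applyUpTo h (length L) ≡ L
enumerator {b} [] = (λ i → i + b) , ≤-refl , (λ i → n<1+n _) , refl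
enumerator {b} {x ∷ L} (b≤x ∷ is) with h , x<h0 , h< , eq ← enumerator is =
  h′ , b≤x , h′< , cong (x ∷_) eq
  where
  h′ : ℕ → ℕ
  h′ zero    = x
  h′ (suc i) = h i
  h′< : ∀ i → h′ i < h′ (suc i)
  h′< zero    = x<h0
  h′< (suc i) = h< i

module _ (h : ℕ → ℕ) (h< : ∀ i → h i < h (suc i)) where

  increasing-mono-≤ : ∀ {a b} → a ≤ b → h a ≤ h b
  increasing-mono-≤ {a} {zero}  z≤n = ≤-refl
  increasing-mono-≤ {a} {suc b} a≤  with m≤n⇒m<n∨m≡n a≤
  ... | inj₁ a<  = ≤-trans (increasing-mono-≤ (s≤s⁻¹ a<)) (<⇒≤ (h< b))
  ... | inj₂ refl = ≤-refl

  increasing-mono-< : ∀ {a b} → a < b → h a < h b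
  increasing-mono-< {a} a<b = <-≤-trans (h< a) (increasing-mono-≤ a<b)

  increasing-cancel-< : ∀ {a b} → h a < h b → a < b
  increasing-cancel-< {a} {b} lt with a <? b
  ... | yes a<b = a<b
  ... | no  a≮b = ⊥-elim (<⇒≱ lt (increasing-mono-≤ (≮⇒≥ a≮b)))

-- Only the relative order of the labels matters, so the count depends on their number alone. This
-- turns the sum over splittings into a binomial sum.
totalCount-relabel : ∀ φ {b L} → Increasing b L → ∀ k → totalCount φ L k ≡ totalCount φ (upTo (length L)) k
totalCount-relabel φ {b} {L} is k with h , _ , h< , eq ← enumerator is = begin
  totalCount φ L k
    ≡⟨ cong (λ M → totalCount φ M k) (trans (map-upTo h (length L)) eq) ⟨
  totalCount φ (map h (upTo (length L))) k
    ≡⟨ ∑pick-map h (upTo (length L)) _ ⟩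
  ∑pick (upTo (length L)) (λ v L′ → count φ (h v ∷ []) 0 (map h L′) k)
    ≡⟨ ∑pick-cong (upTo (length L)) (λ {v} {L′} _ →
         count-map φ h (increasing-mono-< h h<) (increasing-cancel-< h h<) (v ∷ []) 0 L′ k) ⟩
  totalCount φ (upTo (length L)) k ∎
  where open ≡-Reasoning

-- Binomial sums

∑< : ℕ → (ℕ → ℕ) → ℕ
∑< zero    f = 0
∑< (suc n) f = f 0 + ∑< n (f ∘ suc)

∑<-cong : ∀ n {f g : ℕ → ℕ} → (∀ i → i < n → f i ≡ g i) → ∑< n f ≡ ∑< n g
∑<-cong zero    eq = refl
∑<-cong (suc n) eq = cong₂ _+_ (eq 0 (s≤s z≤n)) (∑<-cong n (λ i i<n → eq (suc i) (s≤s i<n)))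

∑<-+ : ∀ n f g → ∑< n (λ i → f i + g i) ≡ ∑< n f + ∑< n g
∑<-+ zero    f g = refl
∑<-+ (suc n) f g = trans (cong (f 0 + g 0 +_) (∑<-+ n _ _)) (interchange (f 0) (g 0) _ _)

∑<-last : ∀ n f → ∑< (suc n) f ≡ ∑< n f + f n
∑<-last zero    f = +-identityʳ (f 0)
∑<-last (suc n) f = trans (cong (f 0 +_) (∑<-last n (f ∘ suc))) (sym (+-assoc (f 0) _ _))

∑<-drop : ∀ k n {f} → (∀ i → i < k → f i ≡ 0) → ∑< n f ≡ ∑< (n ∸ k) (λ i → f (k + i))
∑<-drop zero    n       f≡0 = refl
∑<-drop (suc k) zero    f≡0 = refl
∑<-drop (suc k) (suc n) {f} f≡0 = trans (cong (_+ ∑< n (f ∘ suc)) (f≡0 0 (s≤s z≤n)))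
                                      (∑<-drop k n (λ i i<k → f≡0 (suc i) (s≤s i<k)))

-- Pascal's rule: the first entry goes to the first or to the second subsequence.
∑split-length : ∀ (L : List A) (F : ℕ → ℕ → ℕ) →
  ∑split L (λ xs ys → F (length xs) (length ys)) ≡ ∑< (suc (length L)) (λ i → (length L C i) · F i (length L ∸ i))
∑split-length []      F = sym (trans (+-identityʳ ((0 C 0) · F 0 0)) (*-identityˡ (F 0 0)))
∑split-length (x ∷ L) F = begin
  ∑split L (λ xs ys → F (suc (length xs)) (length ys)) + ∑split L (λ xs ys → F (length xs) (suc (length ys)))
    ≡⟨ cong₂ _+_ (∑split-length L (F ∘ suc)) (∑split-length L (λ i j → F i (suc j))) ⟩
  a + ((n C 0) · F 0 (suc n) + ∑< n (λ i → (n C suc i) · F (suc i) (suc (n ∸ suc i))))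
    ≡⟨ cong (λ s → a + ((n C 0) · F 0 (suc n) + s)) (∑<-cong n (λ i i<n →
         cong (λ j → (n C suc i) · F (suc i) j) (sym (+-∸-assoc 1 i<n)))) ⟩
  a + ((n C 0) · F 0 (suc n) + b)
    ≡⟨ cong (λ s → a + (s · F 0 (suc n) + b)) (trans (nC0 n) (sym (nC0 (suc n)))) ⟩
  a + ((suc n C 0) · F 0 (suc n) + b)
    ≡⟨ rearrange a ((suc n C 0) · F 0 (suc n)) b ⟩
  (suc n C 0) · F 0 (suc n) + (a + (b + 0 · F (suc n) (n ∸ n)))
    -- `n C suc n` vanishes, which supplies the last term that the second sum lacks.
    ≡⟨ cong (λ c → (suc n C 0) · F 0 (suc n) + (a + (b + c · F (suc n) (n ∸ n)))) (k>n⇒nCk≡0 (n<1+n n)) ⟨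
  (suc n C 0) · F 0 (suc n) + (a + (b + (n C suc n) · F (suc n) (n ∸ n)))
    ≡⟨ cong (λ s → (suc n C 0) · F 0 (suc n) + (a + s)) (∑<-last n _) ⟨
  (suc n C 0) · F 0 (suc n) + (a + ∑< (suc n) (λ i → (n C suc i) · F (suc i) (n ∸ i)))
    ≡⟨ cong ((suc n C 0) · F 0 (suc n) +_) (∑<-+ (suc n) (λ i → (n C i) · F (suc i) (n ∸ i)) (λ i → (n C suc i) · F (suc i) (n ∸ i))) ⟨
  (suc n C 0) · F 0 (suc n) + ∑< (suc n) (λ i → (n C i) · F (suc i) (n ∸ i) + (n C suc i) · F (suc i) (n ∸ i))
    ≡⟨ cong ((suc n C 0) · F 0 (suc n) +_) (∑<-cong (suc n) (λ i _ → trans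
         (sym (*-distribʳ-+ (F (suc i) (n ∸ i)) (n C i) (n C suc i)))
         (cong (_· F (suc i) (n ∸ i)) (nCk+nC[k+1]≡[n+1]C[k+1] n i)))) ⟩
  ∑< (suc (suc n)) (λ i → (suc n C i) · F i (suc n ∸ i)) ∎
  where
  open ≡-Reasoning
  n = length L
  a = ∑< (suc n) (λ i → (n C i) · F (suc i) (n ∸ i))
  b = ∑< n (λ i → (n C suc i) · F (suc i) (n ∸ i))
  nC0 : ∀ n → n C 0 ≡ 1
  nC0 n = trans (nCk≡nC[n∸k] {0} {n} z≤n) (nCn≡1 n)
  rearrange : ∀ a s b → a + (s + b) ≡ s + (a + (b + 0))
  rearrange = solve-∀

totalCount-binomial : ∀ φ n k → totalCount φ (upTo (suc n)) k ≡
  ∑< (suc n ∸ k) (λ i → (suc n C suc (k + i)) ·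
    (totalCount (λ _ → δ₀) (upTo (suc (k + i))) k · φ (k + i ∸ k) (n ∸ (k + i))))
totalCount-binomial φ n k = begin
  totalCount φ (upTo (suc n)) k
    ≡⟨ totalCount-split φ (upTo (suc n)) k ⟩
  ∑split (upTo (suc n)) (λ S R → totalCount (λ _ → δ₀) S k · φ (length S ∸ 1 ∸ k) (length R))
    ≡⟨ ∑split-cong-Increasing (upTo-Increasing (suc n)) (λ S R inc →
         cong (_· φ (length S ∸ 1 ∸ k) (length R)) (totalCount-relabel (λ _ → δ₀) inc k)) ⟩
  ∑split (upTo (suc n)) (λ S R → F (length S) (length R))
    ≡⟨ ∑split-length (upTo (suc n)) F ⟩
  ∑< (suc (length (upTo (suc n)))) (λ i → (length (upTo (suc n)) C i) · F i (length (upTo (suc n)) ∸ i))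
    ≡⟨ cong (λ l → ∑< (suc l) (λ i → (l C i) · F i (l ∸ i))) (length-upTo (suc n)) ⟩
  (suc n C 0) · 0 + ∑< (suc n) (λ i → (suc n C suc i) · F (suc i) (n ∸ i))
    -- The term with no label chosen is 0, as there is no root to pick.
    ≡⟨ cong (_+ ∑< (suc n) (λ i → (suc n C suc i) · F (suc i) (n ∸ i))) (*-zeroʳ (suc n C 0)) ⟩
  ∑< (suc n) (λ i → (suc n C suc i) · F (suc i) (n ∸ i))
    -- A subtree with `k` edges needs `suc k` labels, so the sizes `suc i` with `i < k` contribute
    -- nothing.
    ≡⟨ ∑<-drop k (suc n) small ⟩
  ∑< (suc n ∸ k) (λ i → (suc n C suc (k + i)) · F (suc (k + i)) (n ∸ (k + i))) ∎
  where
  open ≡-Reasoning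
  F : ℕ → ℕ → ℕ
  F i j = totalCount (λ _ → δ₀) (upTo i) k · φ (i ∸ 1 ∸ k) j
  small : ∀ i → i < k → (suc n C suc i) · F (suc i) (n ∸ i) ≡ 0
  small i i<k = trans
    (cong (λ t → (suc n C suc i) · (t · φ (i ∸ k) (n ∸ i)))
      (totalCount-vanish (λ _ → δ₀) (upTo (suc i)) k (≤-trans (≤-reflexive (length-upTo (suc i))) i<k)))
    (*-zeroʳ (suc n C suc i))

-- Forests with prescribed roots

forestCount : ℕ → ℕ → ℕ
forestCount zero    j       = δ₀ j
forestCount (suc r) zero    = forestCount r zero
forestCount (suc r) (suc j) = forestCount r (suc j) + suc j · forestCount (suc (suc r)) j

⁽⁾-head : ∀ x j → x ⁽ suc j ⁾ ≡ x · suc x ⁽ j ⁾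
⁽⁾-head x zero    = base x
  where
  base : ∀ x → 1 · (x + 0) ≡ x · 1
  base = solve-∀
⁽⁾-head x (suc j) = trans (cong (_· (x + suc j)) (⁽⁾-head x j)) (shuffle x j (suc x ⁽ j ⁾))
  where
  shuffle : ∀ x j p → x · p · (x + suc j) ≡ x · (p · (suc x + j))
  shuffle = solve-∀

forestCount-0 : ∀ r → forestCount r 0 ≡ 1
forestCount-0 zero    = refl
forestCount-0 (suc r) = forestCount-0 r

-- This is the formula with the factor `r + suc j` of the rising factorial cancelled against the
-- denominator, so that the recurrence can be checked without division.
forestCount-suc : ∀ r j → forestCount r (suc j) ≡ r · suc (r + suc j) ⁽ j ⁾
forestCount-suc zero    j    = refl
forestCount-suc (suc r) zero = trans
  (cong₂ (λ a b → a + 1 · b) (forestCount-suc r 0) (forestCount-0 r)) (base r)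
  where
  base : ∀ r → r · 1 + 1 · 1 ≡ suc r · 1
  base = solve-∀
forestCount-suc (suc r) (suc j) = begin
  forestCount r (2 + j) + (2 + j) · forestCount (2 + r) (suc j)
    ≡⟨ cong₂ (λ a b → a + (2 + j) · b) (forestCount-suc r (suc j)) (forestCount-suc (2 + r) j) ⟩
  r · suc (r + (2 + j)) ⁽ suc j ⁾ + (2 + j) · ((2 + r) · suc (2 + r + suc j) ⁽ j ⁾)
    ≡⟨ cong₂ (λ a b → r · a + (2 + j) · ((2 + r) · b ⁽ j ⁾)) (⁽⁾-head (suc (r + (2 + j))) j)
         (cong (2 +_) (sym (+-suc r (suc j)))) ⟩
  r · (suc (r + (2 + j)) · p) + (2 + j) · ((2 + r) · p)
    ≡⟨ collect r j p ⟩
  suc r · (p · (2 + (r + (2 + j)) + j)) ∎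
  where
  open ≡-Reasoning
  p = (2 + (r + (2 + j))) ⁽ j ⁾
  collect : ∀ r j p → r · (suc (r + (2 + j)) · p) + (2 + j) · ((2 + r) · p) ≡ suc r · (p · (2 + (r + (2 + j)) + j))
  collect = solve-∀

-- The closed form cleared of its denominator; it is used with `r = m ∸ k` and `j = n ∸ m`.
forestCount-⁽⁾ : ∀ r j → r · (r + j) ⁽ j ⁾ ≡ (r + j) · forestCount r j
forestCount-⁽⁾ r zero = trans (base r) (cong ((r + 0) ·_) (sym (forestCount-0 r)))
  where
  base : ∀ r → r · 1 ≡ (r + 0) · 1
  base = solve-∀
forestCount-⁽⁾ r (suc j) = begin
  r · (r + suc j) ⁽ suc j ⁾
    ≡⟨ cong (r ·_) (⁽⁾-head (r + suc j) j) ⟩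
  r · ((r + suc j) · suc (r + suc j) ⁽ j ⁾)
    ≡⟨ shuffle r (r + suc j) (suc (r + suc j) ⁽ j ⁾) ⟩
  (r + suc j) · (r · suc (r + suc j) ⁽ j ⁾)
    ≡⟨ cong ((r + suc j) ·_) (forestCount-suc r j) ⟨
  (r + suc j) · forestCount r (suc j) ∎
  where
  open ≡-Reasoning
  shuffle : ∀ a b c → a · (b · c) ≡ b · (a · c)
  shuffle = solve-∀

-- Decreasing trees

guard : {P : Set} → Dec P → ℕ → ℕ
guard (yes _) d = d
guard (no  _) d = 0

guard-no : ∀ {P : Set} (d : Dec P) {c} → ¬ P → guard d c ≡ 0
guard-no (yes p) ¬p = ⊥-elim (¬p p)
guard-no (no  _) ¬p = refl

guard-yes : ∀ {P : Set} (d : Dec P) {c} → P → guard d c ≡ c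
guard-yes (yes _) p = refl
guard-yes (no ¬p) p = ⊥-elim (¬p p)

guard-*ʳ : ∀ {P : Set} (d : Dec P) a c → guard d (a · c) ≡ guard d a · c
guard-*ʳ (yes _) a c = refl
guard-*ʳ (no  _) a c = refl

-- The number of open child lists that can receive `x` along a decreasing edge.
above : List ℕ → ℕ → ℕ
above []       x = 0
above (u ∷ us) x = guard (x <? u) 1 + above us x

module _ (φ : ℕ → ℕ → ℕ) (φ-0 : ∀ r → φ r 0 ≡ 1) where

  private
    D : List ℕ → ℕ → List ℕ → ℕ
    D us r L = count φ us r L (length L)

  -- Every label must join the subtree; after an increasing child fewer labels than required edges
  -- would be left, so that branch vanishes.
  decreasing-∷ : ∀ u us r L → D (u ∷ us) r L ≡ D us r L + ∑pick L (λ v L′ → guard (v <? u) (D (v ∷ u ∷ us) r L′))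
  decreasing-∷ u us r L = trans (count-∷ φ u us r L (length L)) (cong (D us r L +_) (∑pick-cong L λ {v} {L′} p →
    trans (cong (step (v <? u) (count φ (v ∷ u ∷ us) r L′) (count φ (u ∷ us) (suc r) L′)) (Pick-length p))
          (branch (v <? u) v L′)))
    where
    branch : ∀ {P : Set} (d : Dec P) v L′ →
      step d (count φ (v ∷ u ∷ us) r L′) (count φ (u ∷ us) (suc r) L′) (suc (length L′)) ≡ guard d (D (v ∷ u ∷ us) r L′)
    branch (yes _) v L′ = refl
    branch (no  _) v L′ = count-vanish φ (u ∷ us) (suc r) L′ (suc (length L′)) (n<1+n _)

  decreasing-low : ∀ u us r L → All (u ≤_) L → D (u ∷ us) r L ≡ D us r L
  decreasing-low u us r L u≤L = trans (decreasing-∷ u us r L)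
    (trans (cong (D us r L +_) (∑pick-0 L (λ {v} p → guard-no (v <? u) (≤⇒≯ (proj₁ (Pick-All p u≤L))))))
           (+-identityʳ _))

  -- The smallest label becomes a leaf.  It can be inserted into every child
  -- list of a larger vertex, and each label already present adds two places:
  -- one next to it and one below it.
  decreasing-smallest : ∀ x us r L → All (x <_) L → D us r (x ∷ L) ≡ D us r L · (above us x + 2 · length L)
  decreasing-smallest x = count-induction Smallest base ind
    where
    Smallest : List ℕ → ℕ → List ℕ → Set
    Smallest us r L = All (x <_) L → D us r (x ∷ L) ≡ D us r L · (above us x + 2 · length L)

    base : ∀ r L → All (x <_) L → 0 ≡ δ₀ (length L) · φ r (length L) · (2 · length L)
    base r []      _ = sym (*-zeroʳ (δ₀ 0 · φ r 0))
    base r (_ ∷ _) _ = refl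

    ind : ∀ u us r L → Smallest us r L →
          (∀ {v L′} → Pick v L′ L → Smallest (v ∷ u ∷ us) r L′ × Smallest (u ∷ us) (suc r) L′) →
          Smallest (u ∷ us) r L
    ind u us r L ih₀ ih x<L = cases (x <? u)
     where
     cases : ∀ (d : Dec (x < u)) → D (u ∷ us) r (x ∷ L) ≡ D (u ∷ us) r L · (guard d 1 + above us x + 2 · length L)
     cases (no x≮u) = begin
      D (u ∷ us) r (x ∷ L)
        ≡⟨ decreasing-low u us r (x ∷ L) (≮⇒≥ x≮u ∷ u≤L) ⟩
      D us r (x ∷ L)
        ≡⟨ ih₀ x<L ⟩
      D us r L · (above us x + 2 · length L)
        ≡⟨ cong (_· (above us x + 2 · length L)) (decreasing-low u us r L u≤L) ⟨
      D (u ∷ us) r L · (above us x + 2 · length L) ∎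
      where
      open ≡-Reasoning
      u≤L : All (u ≤_) L
      u≤L = All.map (λ x<v → ≤-trans (≮⇒≥ x≮u) (<⇒≤ x<v)) x<L
     cases (yes x<u) = begin
      D (u ∷ us) r (x ∷ L)
        ≡⟨ decreasing-∷ u us r (x ∷ L) ⟩
      D us r (x ∷ L) + (guard (x <? u) (D (x ∷ u ∷ us) r L) + ∑pick L (λ v L′ → guard (v <? u) (D (v ∷ u ∷ us) r (x ∷ L′))))
        -- The child list of `u` ends, or goes on with `x`, or goes on with some `v` from `L`. In
        -- the second case nothing is smaller than `x`, so the list below `x` closes at once.
        ≡⟨ cong₂ _+_ (ih₀ x<L) (cong₂ _+_
             (trans (guard-yes (x <? u) x<u) (decreasing-low x (u ∷ us) r L (All.map <⇒≤ x<L)))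
             (∑pick-cong L insert)) ⟩
      D us r L · M + (D (u ∷ us) r L + ∑pick L (λ v L′ → guard (v <? u) (D (v ∷ u ∷ us) r L′) · M))
        ≡⟨ cong (λ s → D us r L · M + (D (u ∷ us) r L + s)) (∑pick-*ʳ L _ M) ⟨
      D us r L · M + (D (u ∷ us) r L + ∑pick L (λ v L′ → guard (v <? u) (D (v ∷ u ∷ us) r L′)) · M)
        ≡⟨ collect (D us r L) _ (D (u ∷ us) r L) M ⟩
      D (u ∷ us) r L + (D us r L + ∑pick L (λ v L′ → guard (v <? u) (D (v ∷ u ∷ us) r L′))) · M
        ≡⟨ cong (λ d → D (u ∷ us) r L + d · M) (decreasing-∷ u us r L) ⟨
      D (u ∷ us) r L + D (u ∷ us) r L · M
        ≡⟨ *-suc (D (u ∷ us) r L) M ⟨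
      D (u ∷ us) r L · suc M ∎
      where
      open ≡-Reasoning
      -- `M` omits the one place that `u` itself offers; the case where `x` is the next child of `u`
      -- restores it.
      M = above us x + 2 · length L
      collect : ∀ a s d m → a · m + (d + s · m) ≡ d + (a + s) · m
      collect = solve-∀
      -- Picking `v` costs the two places of a label still present and gains those in the open lists
      -- of `v` and `u`, so the factor is again `M`.
      positions : ∀ a l → 1 + (1 + a) + 2 · l ≡ a + 2 · suc l
      positions = solve-∀
      insert : ∀ {v L′} → Pick v L′ L →
        guard (v <? u) (D (v ∷ u ∷ us) r (x ∷ L′)) ≡ guard (v <? u) (D (v ∷ u ∷ us) r L′) · M
      insert {v} {L′} p with x<v , x<L′ ← Pick-All p x<L = begin
        guard (v <? u) (D (v ∷ u ∷ us) r (x ∷ L′))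
          ≡⟨ cong (guard (v <? u)) (proj₁ (ih p) x<L′) ⟩
        guard (v <? u) (D (v ∷ u ∷ us) r L′ · (above (v ∷ u ∷ us) x + 2 · length L′))
          ≡⟨ cong (λ m → guard (v <? u) (D (v ∷ u ∷ us) r L′ · m)) (trans
               (cong₂ (λ a b → a + (b + above us x) + 2 · length L′) (guard-yes (x <? v) x<v) (guard-yes (x <? u) x<u))
               (trans (positions (above us x) (length L′)) (cong (λ l → above us x + 2 · l) (sym (Pick-length p))))) ⟩
        guard (v <? u) (D (v ∷ u ∷ us) r L′ · M)
          ≡⟨ guard-*ʳ (v <? u) _ M ⟩
        guard (v <? u) (D (v ∷ u ∷ us) r L′) · M ∎

  -- The smallest label cannot be the root while others exist. Under a root `v` there is one place
  -- in the list of `v` and two for each of the `n` other labels.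
  totalCount-decreasing : ∀ n {b L} → Increasing b L → length L ≡ suc n → totalCount φ L n ≡ [2 n -1]!!
  totalCount-decreasing zero    {L = x ∷ []}    (_ ∷ [])  eq = cong (λ c → 1 · c + 0) (φ-0 0)
  totalCount-decreasing (suc n) {L = x ∷ L@(_ ∷ _)} (_ ∷ is) eq = begin
    count φ (x ∷ []) 0 L (suc n) + ∑pick L (λ v L′ → count φ (v ∷ []) 0 (x ∷ L′) (suc n))
      ≡⟨ cong₂ _+_ first (∑pick-cong L rest) ⟩
    ∑pick L (λ v L′ → count φ (v ∷ []) 0 L′ n · (2 · n + 1))
      ≡⟨ ∑pick-*ʳ L (λ v L′ → count φ (v ∷ []) 0 L′ n) (2 · n + 1) ⟨
    totalCount φ L n · (2 · n + 1)
      ≡⟨ *-comm (totalCount φ L n) _ ⟩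
    (2 · n + 1) · totalCount φ L n
      ≡⟨ cong ((2 · n + 1) ·_) (totalCount-decreasing n is |L|≡) ⟩
    (2 · n + 1) · [2 n -1]!! ∎
    where
    open ≡-Reasoning
    |L|≡ : length L ≡ suc n
    |L|≡ = suc-injective eq
    x<L : All (x <_) L
    x<L = Increasing⇒All is
    first : count φ (x ∷ []) 0 L (suc n) ≡ 0
    first = trans (cong (count φ (x ∷ []) 0 L) (sym |L|≡)) (decreasing-low x [] 0 L (All.map <⇒≤ x<L))
    rest : ∀ {v L′} → Pick v L′ L → count φ (v ∷ []) 0 (x ∷ L′) (suc n) ≡ count φ (v ∷ []) 0 L′ n · (2 · n + 1)
    rest {v} {L′} p with x<v , x<L′ ← Pick-All p x<L = begin
      count φ (v ∷ []) 0 (x ∷ L′) (suc n)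
        ≡⟨ cong (count φ (v ∷ []) 0 (x ∷ L′) ∘ suc) (sym |L′|≡) ⟩
      D (v ∷ []) 0 (x ∷ L′)
        ≡⟨ decreasing-smallest x (v ∷ []) 0 L′ x<L′ ⟩
      D (v ∷ []) 0 L′ · (above (v ∷ []) x + 2 · length L′)
        ≡⟨ cong₂ (λ a l → count φ (v ∷ []) 0 L′ l · (a + 0 + 2 · l)) (guard-yes (x <? v) x<v) |L′|≡ ⟩
      count φ (v ∷ []) 0 L′ n · suc (2 · n)
        ≡⟨ cong (count φ (v ∷ []) 0 L′ n ·_) (+-comm 1 (2 · n)) ⟩
      count φ (v ∷ []) 0 L′ n · (2 · n + 1) ∎
      where
      |L′|≡ : length L′ ≡ n
      |L′|≡ = suc-injective (trans (sym (Pick-length p)) |L|≡)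

-- Counted predicates

-- Stated over any type, because the recursion counts tuples of child lists as well as trees.
record Counted {A : Set} (P : A → Set) (c : ℕ) : Set where
  field
    elements : List A
    unique   : Unique elements
    sound    : ∀ {a} → a ∈ elements → P a
    complete : ∀ {a} → P a → a ∈ elements
    size     : length elements ≡ c

open Counted

-- Duplicate-free lists with the same members are permutations of each other. This identifies `o`
-- and `z` with the recursive counts.
Counted-unique : Counted P c → Counted P d → c ≡ d
Counted-unique X Y = trans (sym (size X)) (trans
  (↭-length (∼bag⇒↭ (unique∧set⇒bag (unique X) (unique Y)
    (mk⇔ (complete Y ∘ sound X) (complete X ∘ sound Y)))))
  (size Y))

Counted-∅ : (∀ {a} → ¬ P a) → Counted P 0
Counted-∅ ¬P = record
  { elements = [] ; unique = [] ; sound = λ () ; complete = ⊥-elim ∘ ¬P ; size = refl }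

Counted-singleton : ∀ {P : A → Set} a → P a → (∀ {b} → P b → b ≡ a) → Counted P 1
Counted-singleton a Pa only = record
  { elements = a ∷ [] ; unique = [] ∷ [] ; sound = λ { (here refl) → Pa }
  ; complete = here ∘ only ; size = refl }

Counted-⊎ : Counted P c → Counted Q d → (∀ {a} → P a → Q a → ⊥) →
  (∀ {a} → P a → R a) → (∀ {a} → Q a → R a) → (∀ {a} → R a → P a ⊎ Q a) → Counted R (c + d)
Counted-⊎ X Y disjoint P⇒R Q⇒R R⇒ = record
  { elements = elements X ++ elements Y
  ; unique   = Uniqueₚ.++⁺ (unique X) (unique Y) (λ (a∈ , a∈′) → disjoint (sound X a∈) (sound Y a∈′))
  ; sound    = λ a∈ → [ P⇒R ∘ sound X , Q⇒R ∘ sound Y ]′ (∈-++⁻ (elements X) a∈)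
  ; complete = λ r → [ ∈-++⁺ˡ ∘ complete X , ∈-++⁺ʳ (elements X) ∘ complete Y ]′ (R⇒ r)
  ; size     = trans (length-++ (elements X)) (cong₂ _+_ (size X) (size Y))
  }

Counted-map : ∀ {P : A → Set} {Q : B → Set} (f : A → B) → (∀ {x y} → f x ≡ f y → x ≡ y) →
  (∀ {a} → P a → Q (f a)) → (∀ {b} → Q b → ∃[ a ] P a × b ≡ f a) → Counted P c → Counted Q c
Counted-map {Q = Q} f inj P⇒Q Q⇒ X = record
  { elements = map f (elements X)
  ; unique   = Uniqueₚ.map⁺ inj (unique X)
  ; sound    = λ b∈ → let a , a∈ , b≡ = ∈-map⁻ f b∈ in subst Q (sym b≡) (P⇒Q (sound X a∈))
  ; complete = λ q → let a , p , b≡ = Q⇒ q in subst (_∈ _) (sym b≡) (∈-map⁺ f (complete X p))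
  ; size     = trans (length-map f (elements X)) (size X)
  }

Pick-∈ : ∀ {x : A} {xs L} → Pick x xs L → x ∈ L
Pick-∈ here      = here refl
Pick-∈ (there p) = there (Pick-∈ p)

∈-Pick : ∀ {x : A} {L} → x ∈ L → ∃[ xs ] Pick x xs L
∈-Pick (here refl) = _ , here
∈-Pick (there x∈)  with _ , p ← ∈-Pick x∈ = _ , there p

Pick-↭ : ∀ {x : A} {xs L} → Pick x xs L → x ∷ xs ↭ L
Pick-↭ here      = ↭-refl
Pick-↭ (there p) = ↭-trans (_↭_.swap _ _ ↭-refl) (prep _ (Pick-↭ p))

↭-Pick : ∀ {x : A} {xs L} → x ∷ xs ↭ L → ∃[ L′ ] Pick x L′ L × xs ↭ L′
↭-Pick σ with L′ , p ← ∈-Pick (∈-resp-↭ σ (here refl)) =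
  L′ , p , drop-∷ (↭-trans σ (↭-sym (Pick-↭ p)))

Pick-Unique : ∀ {x : A} {xs L} → Pick x xs L → Unique L → Unique xs
Pick-Unique here      (_ ∷ u) = u
Pick-Unique (there p) (a ∷ u) = proj₂ (Pick-All p a) ∷ Pick-Unique p u

-- By `same`, the picked entry can be recovered from `b`, so different picks give disjoint sets.
Counted-pick : ∀ (L : List A) {Q : A → List A → B → Set} {g} → Unique L →
  (∀ {v w L′ L″ b} → Q v L′ b → Q w L″ b → v ≡ w) →
  (∀ {v L′} → Pick v L′ L → Counted (Q v L′) (g v L′)) →
  Counted (λ b → ∃₂ λ v L′ → Pick v L′ L × Q v L′ b) (∑pick L g)
Counted-pick []      u        same X = Counted-∅ λ { (_ , _ , () , _) }
Counted-pick (x ∷ L) (x∉ ∷ u) same X = Counted-⊎ (X here)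
  (Counted-pick L u same (X ∘ there))
  (λ { q (_ , _ , p , q′) → All.lookup x∉ (Pick-∈ p) (same q q′) })
  (λ q → _ , _ , here , q)
  (λ { (_ , _ , p , q) → _ , _ , there p , q })
  (λ { (_ , _ , here , q) → inj₁ q ; (_ , _ , there p , q) → inj₂ (_ , _ , p , q) })

-- Fillings of slots

labels : ∀ {n} → Vec (List Tree) n → List ℕ
labels []       = []
labels (F ∷ Fs) = verticesᶠ F ++ labels Fs

[]≢∷ : ∀ {t : Tree} {ts : List Tree} → ¬ ([] ≡ t ∷ ts)
[]≢∷ ()

root-injective : ∀ {v w ss ss′} {ts ts′ : List Tree} → node v ss ∷ ts ≡ node w ss′ ∷ ts′ → v ≡ w
root-injective refl = refl

labels-node : ∀ {n} ss ts (Gs : Vec (List Tree) n) →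
  (verticesᶠ ss ++ verticesᶠ ts) ++ labels Gs ↭ verticesᶠ ss ++ verticesᶠ ts ++ labels Gs
labels-node ss ts Gs = ↭-reflexive (++-assoc (verticesᶠ ss) (verticesᶠ ts) (labels Gs))

-- Follows the recurrence of `forestCount`: once the first root is removed, its children and its
-- right siblings form two lists in place of one.
forests-counted : ∀ r L → Unique L → Counted (λ (Gs : Vec (List Tree) r) → labels Gs ↭ L) (forestCount r (length L))
forests-counted r L u = go (length L) r L refl u
  where
  Filling : List ℕ → ∀ {r} → Vec (List Tree) r → Set
  Filling L Gs = labels Gs ↭ L

  EmptyHead : List ℕ → ∀ {r} → Vec (List Tree) (suc r) → Set
  EmptyHead L (F ∷ Gs) = F ≡ [] × labels Gs ↭ L

  FirstRoot : ∀ {r} → ℕ → List ℕ → Vec (List Tree) (suc r) → Set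
  FirstRoot v L′ (F ∷ Gs) = ∃₂ λ ss ts → F ≡ node v ss ∷ ts × verticesᶠ ss ++ verticesᶠ ts ++ labels Gs ↭ L′

  go : ∀ n r L → length L ≡ n → Unique L → Counted (Filling L {r}) (forestCount r n)
  go zero zero [] eq u = Counted-singleton [] ↭-refl λ { {[]} _ → refl }
  go (suc n) zero L eq u = Counted-∅ λ { {[]} σ → 0≢1+n (trans (↭-length σ) eq) }
  go zero (suc r) [] eq u = Counted-map ([] ∷_) (λ { refl → refl }) id
    (λ { {[] ∷ Gs} σ → Gs , σ , refl ; {(node _ _ ∷ _) ∷ Gs} σ → ⊥-elim (0≢1+n (sym (↭-length σ))) })
    (go zero r [] eq u)
  go (suc n) (suc r) L eq u = subst (λ s → Counted (Filling L) (forestCount r (suc n) + s))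
    (trans (∑pick-const L _) (cong (_· forestCount (suc (suc r)) n) eq))
    (Counted-⊎ {P = EmptyHead L} {Q = λ Gs → ∃₂ λ v L′ → Pick v L′ L × FirstRoot v L′ Gs}
      (Counted-map ([] ∷_) (λ { refl → refl }) (refl ,_)
        (λ { {F ∷ Gs} (refl , σ) → Gs , σ , refl }) (go (suc n) r L eq u))
      (Counted-pick L u
        (λ { {b = F ∷ Gs} (_ , _ , e , _) (_ , _ , e′ , _) → root-injective (trans (sym e) e′) })
        (λ {v} p → Counted-map (λ { (ss ∷ ts ∷ Gs) → (node v ss ∷ ts) ∷ Gs })
          (λ { {_ ∷ _ ∷ _} {_ ∷ _ ∷ _} refl → refl })
          (λ { {ss ∷ ts ∷ Gs} σ → ss , ts , refl , σ })
          (λ { {F ∷ Gs} (ss , ts , refl , σ) → ss ∷ ts ∷ Gs , σ , refl })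
          (go n (suc (suc r)) _ (suc-injective (trans (sym (Pick-length p)) eq)) (Pick-Unique p u))))
      (λ { {F ∷ Gs} (e , _) (_ , _ , _ , _ , _ , e′ , _) → []≢∷ (trans (sym e) e′) })
      (λ { {F ∷ Gs} (refl , σ) → σ })
      (λ { {F ∷ Gs} (v , L′ , p , ss , ts , refl , σ) →
           ↭-trans (prep v (↭-trans (labels-node ss ts Gs) σ)) (Pick-↭ p) })
      λ { {[] ∷ Gs} σ → inj₁ (refl , σ)
        ; {(node v ss ∷ ts) ∷ Gs} σ → let L′ , p , τ = ↭-Pick σ in
            inj₂ (v , L′ , p , ss , ts , refl , ↭-trans (↭-sym (labels-node ss ts Gs)) τ) })

-- Fillings of the child lists along the maximal decreasing subtree

mdEdges : ℕ → List Tree → ℕ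
mdEdges u F = length (childEdges u (pruneᶠ u F))

mdEdgesˢ : ∀ (us : List ℕ) → Vec (List Tree) (length us) → ℕ
mdEdgesˢ []       []       = 0
mdEdgesˢ (u ∷ us) (F ∷ Fs) = mdEdges u F + mdEdgesˢ us Fs

-- Outside ψ u F: below a vertex u of the maximal decreasing subtree with
-- children F, the child list of every topmost vertex outside of that subtree
-- satisfies ψ.
Outside : (List Tree → Set) → ℕ → List Tree → Set
Outside ψ u []               = ⊤
Outside ψ u (node v ss ∷ ts) with v <? u
... | yes _ = Outside ψ v ss × Outside ψ u ts
... | no  _ = ψ ss × Outside ψ u ts

Outsideˢ : (List Tree → Set) → ∀ (us : List ℕ) → Vec (List Tree) (length us) → Set
Outsideˢ ψ []       []       = ⊤
Outsideˢ ψ (u ∷ us) (F ∷ Fs) = Outside ψ u F × Outsideˢ ψ us Fs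

Slots : List ℕ → ℕ → Set
Slots us r = Vec (List Tree) (length us) × Vec (List Tree) r

-- Undoes one traversal step: the first two lists are the children of `v` and its later siblings.
attachInside : ∀ {m r} → ℕ → Vec (List Tree) (2 + m) × Vec (List Tree) r → Vec (List Tree) (1 + m) × Vec (List Tree) r
attachInside v (ss ∷ ts ∷ Fs , Gs) = (node v ss ∷ ts) ∷ Fs , Gs

attachOutside : ∀ {m r} → ℕ → Vec (List Tree) (1 + m) × Vec (List Tree) (1 + r) → Vec (List Tree) (1 + m) × Vec (List Tree) r
attachOutside v (ts ∷ Fs , ss ∷ Gs) = (node v ss ∷ ts) ∷ Fs , Gs

attachInside-injective : ∀ {m r} v (x y : Vec (List Tree) (2 + m) × Vec (List Tree) r) →
  attachInside v x ≡ attachInside v y → x ≡ y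
attachInside-injective v (_ ∷ _ ∷ _ , _) (_ ∷ _ ∷ _ , _) refl = refl

attachOutside-injective : ∀ {m r} v (x y : Vec (List Tree) (1 + m) × Vec (List Tree) (1 + r)) →
  attachOutside v x ≡ attachOutside v y → x ≡ y
attachOutside-injective v (_ ∷ _ , _ ∷ _) (_ ∷ _ , _ ∷ _) refl = refl

-- Treats both families at once: `ψ` restricts the child lists of topmost vertices outside the
-- maximal decreasing subtree, and `φ` counts the fillings obeying it. It is always true for `𝒪` and
-- demands an empty list for `𝒵`.
module _ (ψ : List Tree → Set) (φ : ℕ → ℕ → ℕ)
  (free-counted : ∀ r L → Unique L → Counted (λ (Gs : Vec (List Tree) r) → labels Gs ↭ L × VAll ψ Gs) (φ r (length L)))
  where

  Shape : ∀ us {r} → ℕ → Slots us r → Set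
  Shape us k (Fs , Gs) = mdEdgesˢ us Fs ≡ k × Outsideˢ ψ us Fs × VAll ψ Gs

  Filling : ∀ us {r} → List ℕ → ℕ → Slots us r → Set
  Filling us L k (Fs , Gs) = labels Fs ++ labels Gs ↭ L × Shape us k (Fs , Gs)

  EmptyHead : ∀ u us {r} → List ℕ → ℕ → Slots (u ∷ us) r → Set
  EmptyHead u us L k (F ∷ Fs , Gs) = F ≡ [] × Filling us L k (Fs , Gs)

  FirstRoot : ∀ u us {r} → ℕ → ℕ → List ℕ → Slots (u ∷ us) r → Set
  FirstRoot u us k v L′ (F ∷ Fs , Gs) = ∃₂ λ ss ts → F ≡ node v ss ∷ ts ×
    (verticesᶠ ss ++ verticesᶠ ts ++ labels Fs) ++ labels Gs ↭ L′ × Shape (u ∷ us) k (F ∷ Fs , Gs)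

  private
    push-labels : ∀ {m n} ss ts (Fs : Vec (List Tree) m) (Gs : Vec (List Tree) n) →
      (verticesᶠ ts ++ labels Fs) ++ verticesᶠ ss ++ labels Gs ↭ (verticesᶠ ss ++ verticesᶠ ts ++ labels Fs) ++ labels Gs
    push-labels ss ts Fs Gs = ↭-trans (shifts (verticesᶠ ts ++ labels Fs) (verticesᶠ ss))
      (↭-reflexive (sym (++-assoc (verticesᶠ ss) (verticesᶠ ts ++ labels Fs) (labels Gs))))

    node-labels : ∀ {m n} ss ts (Fs : Vec (List Tree) m) (Gs : Vec (List Tree) n) →
      ((verticesᶠ ss ++ verticesᶠ ts) ++ labels Fs) ++ labels Gs ↭ (verticesᶠ ss ++ verticesᶠ ts ++ labels Fs) ++ labels Gs
    node-labels ss ts Fs Gs = ↭-reflexive (cong (_++ labels Gs) (++-assoc (verticesᶠ ss) (verticesᶠ ts) (labels Fs)))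

    mdEdges-node : ∀ u v ss ts rest →
      length (childEdges v (pruneᶠ v ss) ++ childEdges u (pruneᶠ u ts)) + rest ≡ mdEdges v ss + (mdEdges u ts + rest)
    mdEdges-node u v ss ts rest = trans
      (cong (_+ rest) (length-++ (childEdges v (pruneᶠ v ss)))) (+-assoc (mdEdges v ss) _ _)

  firstRoot-counted : ∀ u us r k v L′ →
    (∀ k → Counted (Filling (v ∷ u ∷ us) {r} L′ k) (count φ (v ∷ u ∷ us) r L′ k)) →
    (∀ k → Counted (Filling (u ∷ us) {suc r} L′ k) (count φ (u ∷ us) (suc r) L′ k)) →
    Counted (FirstRoot u us {r} k v L′)
            (step (v <? u) (count φ (v ∷ u ∷ us) r L′) (count φ (u ∷ us) (suc r) L′) k)
  -- The equation is kept because `pruneᶠ` and `Outside` branch on the same decision inside `Shape`.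
  firstRoot-counted u us r k v L′ C₁ C₂ with v <? u in v<?u
  firstRoot-counted u us r zero v L′ C₁ C₂ | yes _ =
    Counted-∅ λ { {F ∷ Fs , Gs} (ss , ts , refl , _ , e , _) → absurd ss ts e }
    where
    absurd : ∀ ss ts {m} → mdEdges u (node v ss ∷ ts) + m ≢ 0
    absurd ss ts e rewrite v<?u with () ← e
  firstRoot-counted u us r (suc k) v L′ C₁ C₂ | yes _ = Counted-map
    (attachInside v)
    (λ {x} {y} → attachInside-injective v x y)
    (λ { {ss ∷ ts ∷ Fs , Gs} (σ , s) → ss , ts , refl , σ , to ss ts s })
    (λ { {F ∷ Fs , Gs} (ss , ts , refl , σ , s) → (ss ∷ ts ∷ Fs , Gs) , (σ , from ss ts s) , refl })
    (C₁ k)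
    where
    to : ∀ ss ts {Fs} {Gs : Vec _ r} → Shape (v ∷ u ∷ us) k (ss ∷ ts ∷ Fs , Gs) →
         Shape (u ∷ us) (suc k) ((node v ss ∷ ts) ∷ Fs , Gs)
    to ss ts {Fs} (e , (a , b , c) , all) rewrite v<?u =
      cong suc (trans (mdEdges-node u v ss ts (mdEdgesˢ us Fs)) e) , ((a , b) , c) , all
    from : ∀ ss ts {Fs} {Gs : Vec _ r} → Shape (u ∷ us) (suc k) ((node v ss ∷ ts) ∷ Fs , Gs) →
           Shape (v ∷ u ∷ us) k (ss ∷ ts ∷ Fs , Gs)
    from ss ts {Fs} s rewrite v<?u with (e , ((a , b) , c) , all) ← s =
      trans (sym (mdEdges-node u v ss ts (mdEdgesˢ us Fs))) (suc-injective e) , (a , b , c) , all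
  firstRoot-counted u us r k v L′ C₁ C₂ | no _ = Counted-map
    (attachOutside v)
    (λ {x} {y} → attachOutside-injective v x y)
    (λ { {ts ∷ Fs , ss ∷ Gs} (σ , s) → ss , ts , refl , ↭-trans (↭-sym (push-labels ss ts Fs Gs)) σ , to ss ts s })
    (λ { {F ∷ Fs , Gs} (ss , ts , refl , σ , s) →
         (ts ∷ Fs , ss ∷ Gs) , (↭-trans (push-labels ss ts Fs Gs) σ , from ss ts s) , refl })
    (C₂ k)
    where
    to : ∀ ss ts {Fs} {Gs : Vec _ r} → Shape (u ∷ us) k (ts ∷ Fs , ss ∷ Gs) →
         Shape (u ∷ us) k ((node v ss ∷ ts) ∷ Fs , Gs)
    to ss ts (e , (b , c) , a ∷ all) rewrite v<?u = e , ((a , b) , c) , all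
    from : ∀ ss ts {Fs} {Gs : Vec _ r} → Shape (u ∷ us) k ((node v ss ∷ ts) ∷ Fs , Gs) →
           Shape (u ∷ us) k (ts ∷ Fs , ss ∷ Gs)
    from ss ts s rewrite v<?u with (e , ((a , b) , c) , all) ← s = e , (b , c) , a ∷ all

  -- Follows `count-∷`: fillings are divided by whether the first child list is empty and, if not,
  -- by the label of its first root.
  filling-counted : ∀ us r L → Unique L → ∀ k → Counted (Filling us {r} L k) (count φ us r L k)
  filling-counted = count-induction
    (λ us r L → Unique L → ∀ k → Counted (Filling us {r} L k) (count φ us r L k)) base ind
    where
    base : ∀ r L → Unique L → ∀ k → Counted (Filling [] {r} L k) (δ₀ k · φ r (length L))
    base r L u (suc k) = Counted-∅ λ { {[] , Gs} (_ , () , _) }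
    base r L u zero = subst (Counted _) (sym (+-identityʳ (φ r (length L)))) (Counted-map ([] ,_)
      (λ { refl → refl }) (λ (σ , all) → σ , refl , tt , all)
      (λ { {[] , Gs} (σ , _ , _ , all) → Gs , (σ , all) , refl })
      (free-counted r L u))

    ind : ∀ u us r L → (Unique L → ∀ k → Counted (Filling us {r} L k) (count φ us r L k)) →
      (∀ {v L′} → Pick v L′ L →
        (Unique L′ → ∀ k → Counted (Filling (v ∷ u ∷ us) {r} L′ k) (count φ (v ∷ u ∷ us) r L′ k)) ×
        (Unique L′ → ∀ k → Counted (Filling (u ∷ us) {suc r} L′ k) (count φ (u ∷ us) (suc r) L′ k))) →
      Unique L → ∀ k → Counted (Filling (u ∷ us) {r} L k) (count φ (u ∷ us) r L k)
    ind u us r L ih₀ ih uniq k = subst (Counted _) (sym (count-∷ φ u us r L k))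
      (Counted-⊎ {P = EmptyHead u us L k} {Q = λ s → ∃₂ λ v L′ → Pick v L′ L × FirstRoot u us k v L′ s}
        (Counted-map (λ (Fs , Gs) → [] ∷ Fs , Gs) (λ { refl → refl }) (refl ,_)
          (λ { {F ∷ Fs , Gs} (refl , f) → (Fs , Gs) , f , refl }) (ih₀ uniq k))
        (Counted-pick L uniq
          (λ { {b = F ∷ Fs , Gs} (_ , _ , e , _) (_ , _ , e′ , _) → root-injective (trans (sym e) e′) })
          (λ {v} {L′} p → firstRoot-counted u us r k v L′
            (proj₁ (ih p) (Pick-Unique p uniq)) (proj₂ (ih p) (Pick-Unique p uniq))))
        (λ { {F ∷ Fs , Gs} (e , _) (_ , _ , _ , _ , _ , e′ , _) → []≢∷ (trans (sym e) e′) })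
        (λ { {F ∷ Fs , Gs} (refl , σ , e , o , all) → σ , e , (tt , o) , all })
        (λ { {F ∷ Fs , Gs} (v , L′ , p , ss , ts , refl , σ , s) →
             ↭-trans (prep v (↭-trans (node-labels ss ts Fs Gs) σ)) (Pick-↭ p) , s })
        λ { {[] ∷ Fs , Gs} (σ , e , (_ , o) , all) → inj₁ (refl , σ , e , o , all)
          ; {(node v ss ∷ ts) ∷ Fs , Gs} (σ , s) → let L′ , p , τ = ↭-Pick σ in
              inj₂ (v , L′ , p , ss , ts , refl , ↭-trans (↭-sym (node-labels ss ts Fs Gs)) τ , s) })

  TreeShape : List ℕ → ℕ → Tree → Set
  TreeShape L k (node u ts) = vertices (node u ts) ↭ L × mdEdges u ts ≡ k × Outside ψ u ts

  tree-counted : ∀ L → Unique L → ∀ k → Counted (TreeShape L k) (totalCount φ L k)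
  tree-counted L uniq k = Counted-map id id
    (λ { {node u ts} (v , L′ , p , refl , σ , s) → ↭-trans (prep v σ) (Pick-↭ p) , s })
    (λ { {node u ts} (σ , s) → let L′ , p , τ = ↭-Pick σ in
           node u ts , (u , L′ , p , refl , τ , s) , refl })
    (Counted-pick L {Q = Rooted} uniq
      (λ { {b = node u ts} (refl , _) (refl , _) → refl })
      (λ {v} {L′} p → Counted-map (λ { (ts ∷ [] , []) → node v ts })
        (λ { {_ ∷ [] , []} {_ ∷ [] , []} refl → refl })
        (λ { {ts ∷ [] , []} (σ , e , (o , _) , _) → refl , subst (_↭ L′) (unit ts) σ , trans (sym (+-identityʳ _)) e , o })
        (λ { {node u ts} (refl , σ , e , o) →
             (ts ∷ [] , []) , (subst (_↭ L′) (sym (unit ts)) σ , trans (+-identityʳ _) e , (o , tt) , []) , refl })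
        (filling-counted (v ∷ []) 0 L′ (Pick-Unique p uniq) k)))
    where
    Rooted : ℕ → List ℕ → Tree → Set
    Rooted v L′ (node u ts) = v ≡ u × verticesᶠ ts ↭ L′ × mdEdges u ts ≡ k × Outside ψ u ts
    unit : ∀ ts → (verticesᶠ ts ++ []) ++ [] ≡ verticesᶠ ts
    unit ts = trans (++-identityʳ _) (++-identityʳ _)

All∩Any : ∀ {A : Set} {P Q : A → Set} {xs} → All P xs → Any Q xs → Any (λ x → P x × Q x) xs
All∩Any (p ∷ _)  (here q)  = here (p , q)
All∩Any (_ ∷ ps) (there i) = there (All∩Any ps i)

Unique-++⁻ : ∀ {A : Set} (xs : List A) {ys} → Unique (xs ++ ys) → Unique xs × Unique ys × Disjoint xs ys
Unique-++⁻ []       uniq        = [] , uniq , λ { (() , _) }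
Unique-++⁻ (x ∷ xs) (x∉ ∷ uniq) with uniqˣ , uniqʸ , disjoint ← Unique-++⁻ xs uniq =
  Allₚ.++⁻ˡ xs x∉ ∷ uniqˣ , uniqʸ ,
  λ { (here refl , v∈ys) → All.lookup x∉ (∈-++⁺ʳ xs v∈ys) refl ; (there v∈xs , v∈ys) → disjoint (v∈xs , v∈ys) }

-- The families 𝒪 and 𝒵

isTreeOn⇒↭ : ∀ {n} T → IsTreeOn n T → vertices T ↭ upTo (suc n)
isTreeOn⇒↭ {n} T (uniq , range) = ∼bag⇒↭ (unique∧set⇒bag uniq (Uniqueₚ.upTo⁺ (suc n)) (λ {v} → mk⇔
  (λ v∈ → ∈-upTo⁺ (s≤s (Equivalence.to (range v) v∈)))
  (λ v∈ → Equivalence.from (range v) (s≤s⁻¹ (∈-upTo⁻ v∈)))))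

↭⇒isTreeOn : ∀ {n} T → vertices T ↭ upTo (suc n) → IsTreeOn n T
↭⇒isTreeOn {n} T σ =
  Permutationₛ.Unique-resp-↭ (setoid ℕ) (↭⇒↭ₛ (↭-sym σ)) (Uniqueₚ.upTo⁺ (suc n)) ,
  λ v → mk⇔ (λ v∈ → s≤s⁻¹ (∈-upTo⁻ (∈-resp-↭ σ v∈))) (λ v≤n → ∈-resp-↭ (↭-sym σ) (∈-upTo⁺ (s≤s v≤n)))

Enumeration⇒Counted : ∀ {P} (E : Enumeration P) → Counted P (card E)
Enumeration⇒Counted E = record
  { elements = Enumeration.elements E
  ; unique   = Enumeration.unique E
  ; sound    = Equivalence.to (Enumeration.∈⇔ E)
  ; complete = Equivalence.from (Enumeration.∈⇔ E)
  ; size     = refl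
  }

outside-⊤ : ∀ u F → Outside (λ _ → ⊤) u F
outside-⊤ u []               = tt
outside-⊤ u (node v ss ∷ ts) with v <? u
... | yes _ = outside-⊤ v ss , outside-⊤ u ts
... | no  _ = tt , outside-⊤ u ts

o-totalCount : ∀ n k → o n k ≡ totalCount forestCount (upTo (suc n)) k
o-totalCount n k = Counted-unique (Enumeration⇒Counted (𝒪-enumeration n k)) (Counted-map id id
  (λ { {node u ts} (σ , e , _) → ↭⇒isTreeOn (node u ts) σ , e })
  (λ { {node u ts} (on , e) → node u ts , (isTreeOn⇒↭ (node u ts) on , e , outside-⊤ u ts) , refl })
  (tree-counted (λ _ → ⊤) forestCount
    (λ r L u → Counted-map id id (λ {Gs} σ → σ , VecAll.universal (λ _ → tt) Gs) (λ (σ , _) → _ , σ , refl) (forests-counted r L u))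
    (upTo (suc n)) (Uniqueₚ.upTo⁺ (suc n)) k))

-- Trees whose vertices outside the maximal decreasing subtree are leaves

labels-empty : ∀ {r} {Gs : Vec (List Tree) r} → VAll (_≡ []) Gs → labels Gs ≡ []
labels-empty []           = refl
labels-empty (refl ∷ all) = labels-empty all

empties-counted : ∀ r L → Counted (λ (Gs : Vec (List Tree) r) → labels Gs ↭ L × VAll (_≡ []) Gs) (δ₀ (length L))
empties-counted r [] = Counted-singleton (Vec.replicate r []) (↭-reflexive (labels-empty (empty r)) , empty r)
  (only ∘ proj₂)
  where
  empty : ∀ r → VAll (_≡ []) (Vec.replicate r [])
  empty zero    = []
  empty (suc r) = refl ∷ empty r
  only : ∀ {r} {Gs : Vec (List Tree) r} → VAll (_≡ []) Gs → Gs ≡ Vec.replicate r []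
  only []           = refl
  only (refl ∷ all) = cong ([] ∷_) (only all)
empties-counted r (x ∷ L) = Counted-∅ λ (σ , all) →
  0≢1+n (trans (sym (cong length (labels-empty all))) (↭-length σ))

Leafy : ℕ → List Tree → Set
Leafy = Outside (_≡ [])

-- An increasing child has no children, so no edge starts outside the maximal decreasing subtree.
-- This yields both the leaf condition and the parent condition of `𝒵`.
leafy⇒parents : ∀ u F → Leafy u F → All (λ e → proj₁ e ∈ u ∷ verticesᶠ (pruneᶠ u F)) (childEdges u F)
leafy⇒parents u []               _ = []
leafy⇒parents u (node v ss ∷ ts) l with v <? u
... | yes _ = here refl ∷ Allₚ.++⁺ (All.map (there ∘ ∈-++⁺ˡ) (leafy⇒parents v ss (proj₁ l)))
                (All.map later (leafy⇒parents u ts (proj₂ l)))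
  where
  later : ∀ {w} → w ∈ u ∷ verticesᶠ (pruneᶠ u ts) → w ∈ u ∷ (v ∷ verticesᶠ (pruneᶠ v ss)) ++ verticesᶠ (pruneᶠ u ts)
  later (here e)   = here e
  later (there w∈) = there (∈-++⁺ʳ (v ∷ verticesᶠ (pruneᶠ v ss)) w∈)
... | no _ with refl , l′ ← l = here refl ∷ leafy⇒parents u ts l′

∈⇒child : ∀ u F {w} → w ∈ verticesᶠ F → Any (λ e → proj₂ e ≡ w) (childEdges u F)
∈⇒child u (node v ss ∷ ts) (here refl) = here refl
∈⇒child u (node v ss ∷ ts) (there w∈) with ∈-++⁻ (verticesᶠ ss) w∈
... | inj₁ w∈ss = there (Anyₚ.++⁺ˡ (∈⇒child v ss w∈ss))
... | inj₂ w∈ts = there (Anyₚ.++⁺ʳ (childEdges v ss) (∈⇒child u ts w∈ts))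

prune⊆ : ∀ u F {w} → w ∈ verticesᶠ (pruneᶠ u F) → w ∈ verticesᶠ F
prune⊆ u (node v ss ∷ ts) w∈ with v <? u
... | no _ = there (∈-++⁺ʳ (verticesᶠ ss) (prune⊆ u ts w∈))
prune⊆ u (node v ss ∷ ts) (here e)   | yes _ = here e
prune⊆ u (node v ss ∷ ts) (there w∈) | yes _ with ∈-++⁻ (verticesᶠ (pruneᶠ v ss)) w∈
... | inj₁ w∈ss = there (∈-++⁺ˡ (prune⊆ v ss w∈ss))
... | inj₂ w∈ts = there (∈-++⁺ʳ (verticesᶠ ss) (prune⊆ u ts w∈ts))

-- The hypothesis speaks of labels while pruning acts on positions; uniqueness ensures that a label
-- cut off at one place does not survive at another.
leaves⇒leafy : ∀ u F → Unique (verticesᶠ F) →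
  (∀ {w} → w ∈ verticesᶠ F → w ∉ verticesᶠ (pruneᶠ u F) → All (λ e → proj₁ e ≢ w) (childEdges u F)) → Leafy u F
leaves⇒leafy u []               _        _      = tt
leaves⇒leafy u (node v ss ∷ ts) (v∉ ∷ uniq) leaves with v <? u
... | yes _ =
  leaves⇒leafy v ss uniqˢ (λ w∈ w∉ → Allₚ.++⁻ˡ (childEdges v ss) (All.tail (leaves (there (∈-++⁺ˡ w∈))
    λ { (here refl) → All.lookup v∉ (∈-++⁺ˡ w∈) refl
      ; (there w∈′) → [ w∉ , (λ w∈ts → disjoint (w∈ , prune⊆ u ts w∈ts)) ]′ (∈-++⁻ (verticesᶠ (pruneᶠ v ss)) w∈′) }))) ,
  leaves⇒leafy u ts uniqᵗ (λ w∈ w∉ → Allₚ.++⁻ʳ (childEdges v ss) (All.tail (leaves (there (∈-++⁺ʳ (verticesᶠ ss) w∈))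
    λ { (here refl) → All.lookup v∉ (∈-++⁺ʳ (verticesᶠ ss) w∈) refl
      ; (there w∈′) → [ (λ w∈ss → disjoint (prune⊆ v ss w∈ss , w∈)) , w∉ ]′ (∈-++⁻ (verticesᶠ (pruneᶠ v ss)) w∈′) })))
  where
  uniqˢ    = proj₁ (Unique-++⁻ (verticesᶠ ss) uniq)
  uniqᵗ    = proj₁ (proj₂ (Unique-++⁻ (verticesᶠ ss) uniq))
  disjoint = proj₂ (proj₂ (Unique-++⁻ (verticesᶠ ss) uniq))
-- Here `v` itself is cut off, so no edge may start at it and its child list is empty.
... | no _ = childless ss (All.tail (leaves (here refl)
    (λ v∈ → All.lookup v∉ (∈-++⁺ʳ (verticesᶠ ss) (prune⊆ u ts v∈)) refl))) ,
  leaves⇒leafy u ts (proj₁ (proj₂ (Unique-++⁻ (verticesᶠ ss) uniq)))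
    (λ w∈ w∉ → Allₚ.++⁻ʳ (childEdges v ss) (All.tail (leaves (there (∈-++⁺ʳ (verticesᶠ ss) w∈)) w∉)))
  where
  childless : ∀ ss → All (λ e → proj₁ e ≢ v) (childEdges v ss ++ childEdges u ts) → ss ≡ []
  childless []             _       = refl
  childless (node _ _ ∷ _) (v≢ ∷ _) = ⊥-elim (v≢ refl)

z-totalCount : ∀ n k → z n k ≡ totalCount (λ _ → δ₀) (upTo (suc n)) k
z-totalCount n k = Counted-unique (Enumeration⇒Counted (𝒵-enumeration n k)) (Counted-map id id
  (λ { {node u ts} (σ , e , l) → (↭⇒isTreeOn (node u ts) σ , e) , All.tabulate (to u ts l) })
  (λ { {node u ts} ((on , e) , outside) →
       node u ts , (isTreeOn⇒↭ (node u ts) on , e , from u ts (proj₁ on) outside) , refl })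
  (tree-counted (_≡ []) (λ _ → δ₀) (λ r L _ → empties-counted r L) (upTo (suc n)) (Uniqueₚ.upTo⁺ (suc n)) k))
  where
  Attached : Tree → ℕ → Set
  Attached T v = v ∉ vertices (MD T) → IsLeaf T v × ParentIn (vertices (MD T)) T v

  to : ∀ u ts → Leafy u ts → ∀ {v} → v ∈ vertices (node u ts) → Attached (node u ts) v
  to u ts l (here refl) v∉ = ⊥-elim (v∉ (here refl))
  to u ts l (there v∈)  v∉ =
    All.map (λ p∈ p≡v → v∉ (subst (_∈ _) p≡v p∈)) parents ,
    Any.map (λ { (p∈ , refl) → refl , p∈ }) (All∩Any parents (∈⇒child u ts v∈))
    where parents = leafy⇒parents u ts l

  from : ∀ u ts → Unique (vertices (node u ts)) → All (Attached (node u ts)) (vertices (node u ts)) → Leafy u ts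
  from u ts (u∉ ∷ uniq) (_ ∷ attached) = leaves⇒leafy u ts uniq λ w∈ w∉ →
    proj₁ (All.lookup attached w∈ λ { (here refl) → All.lookup u∉ w∈ refl ; (there w∈′) → w∉ w∈′ })

-- Rational arithmetic

open import Data.Integer.Base as ℤ using (+_)
import Data.Integer.Properties as ℤ
open import Data.Rational.Base as ℚ using (ℚ; 0ℚ; _*_; _/_; fromℚᵘ)
import Data.Rational.Properties as ℚ
open import Data.Rational.Unnormalised.Base as ℚᵘ using (mkℚᵘ; *≡*)
import Data.Rational.Unnormalised.Properties as ℚᵘ

-- Values of `fromℕ` and quotients are values of `fromℚᵘ`, so products can be computed on
-- unnormalised fractions, without reducing to lowest terms.
fromℚᵘ-* : ∀ p q → fromℚᵘ p * fromℚᵘ q ≡ fromℚᵘ (p ℚᵘ.* q)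
fromℚᵘ-* p q = ℚ.toℚᵘ-injective (ℚᵘ.≃-trans (ℚ.toℚᵘ-homo-* (fromℚᵘ p) (fromℚᵘ q))
  (ℚᵘ.≃-trans (ℚᵘ.*-cong (ℚ.toℚᵘ-fromℚᵘ p) (ℚ.toℚᵘ-fromℚᵘ q)) (ℚᵘ.≃-sym (ℚ.toℚᵘ-fromℚᵘ (p ℚᵘ.* q)))))

fromℚᵘ-+ : ∀ p q → fromℚᵘ p ℚ.+ fromℚᵘ q ≡ fromℚᵘ (p ℚᵘ.+ q)
fromℚᵘ-+ p q = ℚ.toℚᵘ-injective (ℚᵘ.≃-trans (ℚ.toℚᵘ-homo-+ (fromℚᵘ p) (fromℚᵘ q))
  (ℚᵘ.≃-trans (ℚᵘ.+-cong (ℚ.toℚᵘ-fromℚᵘ p) (ℚ.toℚᵘ-fromℚᵘ q)) (ℚᵘ.≃-sym (ℚ.toℚᵘ-fromℚᵘ (p ℚᵘ.+ q)))))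

fromℕ-+ : ∀ a b → fromℕ (a + b) ≡ fromℕ a ℚ.+ fromℕ b
fromℕ-+ a b = sym (trans (fromℚᵘ-+ (mkℚᵘ (+ a) 0) (mkℚᵘ (+ b) 0))
  (cong fromℕ′ (cong₂ ℤ._+_ (ℤ.*-identityʳ (+ a)) (ℤ.*-identityʳ (+ b)))))
  where
  fromℕ′ : ℤ.ℤ → ℚ
  fromℕ′ i = i / 1

fromℕ-* : ∀ a b → fromℕ (a · b) ≡ fromℕ a * fromℕ b
fromℕ-* a b = sym (trans (fromℚᵘ-* (mkℚᵘ (+ a) 0) (mkℚᵘ (+ b) 0)) (cong (_/ 1) (sym (ℤ.pos-* a b))))

/-*-fromℕ : ∀ a d c f .{{_ : NonZero d}} → a · c ≡ d · f → (+ a / d) * fromℕ c ≡ fromℕ f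
/-*-fromℕ a (suc d) c f eq = trans (fromℚᵘ-* (mkℚᵘ (+ a) d) (mkℚᵘ (+ c) 0)) (ℚ.fromℚᵘ-cong {p} {q} (*≡* cross))
  where
  open ≡-Reasoning
  p = mkℚᵘ (+ a) d ℚᵘ.* mkℚᵘ (+ c) 0
  q = mkℚᵘ (+ f) 0
  cross : (+ a ℤ.* + c) ℤ.* + 1 ≡ + f ℤ.* + (suc d · 1)
  cross = begin
    (+ a ℤ.* + c) ℤ.* + 1  ≡⟨ ℤ.*-identityʳ _ ⟩
    + a ℤ.* + c            ≡⟨ ℤ.pos-* a c ⟨
    + (a · c)            ≡⟨ cong +_ eq ⟩
    + (suc d · f)        ≡⟨ cong +_ (*-comm (suc d) f) ⟩
    + (f · suc d)        ≡⟨ cong (λ e → + (f · e)) (*-identityʳ (suc d)) ⟨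
    + (f · (suc d · 1)) ≡⟨ ℤ.pos-* f (suc d · 1) ⟩
    + f ℤ.* + (suc d · 1) ∎

fromℕ-∑< : ∀ N (g : ℕ → ℕ) (f : ℕ → ℚ) → (∀ i → i < N → fromℕ (g i) ≡ f i) →
  fromℕ (∑< N g) ≡ foldr ℚ._+_ 0ℚ (applyUpTo f N)
fromℕ-∑< zero    g f eq = refl
fromℕ-∑< (suc N) g f eq = trans (fromℕ-+ (g 0) _)
  (cong₂ ℚ._+_ (eq 0 (s≤s z≤n)) (fromℕ-∑< N (g ∘ suc) (f ∘ suc) (λ i i<N → eq (suc i) (s≤s i<N))))

-- The formula for `o n k` and the value of `o n n`

theorem3 : ((n k : ℕ) (k<n : k < n) →
    fromℕ (o n k) ≡ (∑[ k ≤ m ≤ n ] (fromℕ (suc n C suc m) * fromℕ (z m k) * (_/_ (+ (m ∸ k)) (n ∸ k) {{∸-nonZero k<n}}) * fromℕ ((n ∸ k) ⁽ n ∸ m ⁾))))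
    × ((n : ℕ) → o n n ≡ [2 n -1]!!)
theorem3 = formula , λ n → trans (o-totalCount n n)
  (totalCount-decreasing forestCount forestCount-0 n (upTo-Increasing (suc n)) (length-upTo (suc n)))
  where
  open ≡-Reasoning
  formula : (n k : ℕ) (k<n : k < n) →
    fromℕ (o n k) ≡ (∑[ k ≤ m ≤ n ] (fromℕ (suc n C suc m) * fromℕ (z m k) * (_/_ (+ (m ∸ k)) (n ∸ k) {{∸-nonZero k<n}}) * fromℕ ((n ∸ k) ⁽ n ∸ m ⁾)))
  formula n k k<n = begin
    fromℕ (o n k)
      ≡⟨ cong fromℕ (trans (o-totalCount n k) (totalCount-binomial forestCount n k)) ⟩
    fromℕ (∑< (suc n ∸ k) (λ i → (suc n C suc (k + i)) ·
      (totalCount (λ _ → δ₀) (upTo (suc (k + i))) k · forestCount (k + i ∸ k) (n ∸ (k + i)))))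
      -- From `i < suc n ∸ k` follows `k + i ≤ n`, since `k ≤ suc n` makes the subtraction exact.
      ≡⟨ fromℕ-∑< (suc n ∸ k) _ (λ i → term (k + i)) (λ i i< → summand (k + i) (m≤m+n k i)
           (s≤s⁻¹ (<-≤-trans (+-monoʳ-< k i<) (≤-reflexive (m+[n∸m]≡n (m≤n⇒m≤1+n (<⇒≤ k<n))))))) ⟩
    foldr ℚ._+_ 0ℚ (applyUpTo (λ i → term (k + i)) (suc n ∸ k))
      ≡⟨ cong (foldr ℚ._+_ 0ℚ) (map-upTo (λ i → term (k + i)) (suc n ∸ k)) ⟨
    (∑[ k ≤ m ≤ n ] term m) ∎
    where
    ratio : ℕ → ℚ
    ratio m = _/_ (+ (m ∸ k)) (n ∸ k) {{∸-nonZero k<n}}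
    term : ℕ → ℚ
    term m = fromℕ (suc n C suc m) * fromℕ (z m k) * ratio m * fromℕ ((n ∸ k) ⁽ n ∸ m ⁾)
    summand : ∀ m → k ≤ m → m ≤ n →
      fromℕ ((suc n C suc m) · (totalCount (λ _ → δ₀) (upTo (suc m)) k · forestCount (m ∸ k) (n ∸ m))) ≡ term m
    summand m k≤m m≤n = begin
      fromℕ ((suc n C suc m) · (totalCount (λ _ → δ₀) (upTo (suc m)) k · F))
        ≡⟨ cong (λ t → fromℕ ((suc n C suc m) · (t · F))) (z-totalCount m k) ⟨
      fromℕ ((suc n C suc m) · (z m k · F))
        ≡⟨ cong fromℕ (*-assoc (suc n C suc m) (z m k) F) ⟨
      fromℕ ((suc n C suc m) · z m k · F)
        ≡⟨ trans (fromℕ-* ((suc n C suc m) · z m k) F) (cong (_* fromℕ F) (fromℕ-* (suc n C suc m) (z m k))) ⟩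
      fromℕ (suc n C suc m) * fromℕ (z m k) * fromℕ F
        ≡⟨ cong (fromℕ (suc n C suc m) * fromℕ (z m k) *_)
             (/-*-fromℕ (m ∸ k) (n ∸ k) ((n ∸ k) ⁽ n ∸ m ⁾) F {{∸-nonZero k<n}} scaled) ⟨
      fromℕ (suc n C suc m) * fromℕ (z m k) * (ratio m * fromℕ ((n ∸ k) ⁽ n ∸ m ⁾))
        ≡⟨ ℚ.*-assoc (fromℕ (suc n C suc m) * fromℕ (z m k)) (ratio m) (fromℕ ((n ∸ k) ⁽ n ∸ m ⁾)) ⟨
      term m ∎
      where
      F = forestCount (m ∸ k) (n ∸ m)
      -- The number of lists and the number of labels put into them add up to the base of the rising
      -- factorial.
      parts : m ∸ k + (n ∸ m) ≡ n ∸ k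
      parts = trans (sym (+-∸-comm (n ∸ m) k≤m)) (cong (_∸ k) (m+[n∸m]≡n m≤n))
      scaled : (m ∸ k) · (n ∸ k) ⁽ n ∸ m ⁾ ≡ (n ∸ k) · F
      scaled = subst (λ N → (m ∸ k) · N ⁽ n ∸ m ⁾ ≡ N · F) parts (forestCount-⁽⁾ (m ∸ k) (n ∸ m))
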